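{- Let $G$ be a $K_4$-minor-free graph and let $x,y$ be distinct vertices of $G$. Then $G$ is $(2,2)$-AT extendable with respect to $(x,y)$. Moreover, if $\{x,y\}$ is not connected by a chain of diamonds, then $G$ is $(2,1)$-AT extendable with respect to $(x,y)$.
   Context: All graphs are simple. For an orientation $D$ of $G$, an Eulerian sub-digraph is a spanning sub-digraph $F$ of $D$ with $d_F^+(v)=d_F^-(v)$ for every vertex $v$; $\mathrm{diff}(D)$ is the number of Eulerian sub-digraphs with an even number of arcs minus the number with an odd number of arcs. $D$ is an AT-orientation if $\mathrm{diff}(D)\neq 0$. For $f:V(G)\to\mathbb{N}$, $G$ is $f$-AT if $G$ has an AT-orientation $D$ with $d_D^+(v)\le f(v)-1$ for every vertex $v$. Given distinct vertices $v_1,\dots,v_k$ and integers $a_i\in\{1,2\}$, define $f(v_i)=a_i$ and $f(v)=3$ for all other $v$; $G$ is $(a_1,\dots,a_k)$-AT extendable with respect to $(v_1,\dots,v_k)$ if $G$ is $f$-AT. For $n\in\mathbb{N}$, the chain of diamonds $D_n$ is the graph with vertex set $\{u_i,v_i,w_i: i\in[n]\}\cup\{u_0\}$ and edge set $\{u_{i-1}v_i,u_{i-1}w_i,v_iw_i,v_iu_i,w_iu_i: i\in[n]\}$; let $U(D_n)=\{u_0,\dots,u_n\}$. A set $X$ of distinct vertices of $G$ is connected by a chain of diamonds if there exist $n\in\mathbb{N}$ and a graph homomorphism $\varphi:D_n\to G$ with $X\subseteq\varphi(U(D_n))$. -}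

module Defs where

open import Data.Nat using (ℕ; zero; suc; _≤_; _∸_; _≡ᵇ_)
open import Data.Nat.Properties using ()
open import Data.Bool using (Bool; true; false; not; if_then_else_; _∧_)
open import Data.Fin using (Fin; inject₁) renaming (suc to fsuc)
open import Data.Fin.Properties using () renaming (_≟_ to _≟F_)
open import Data.Integer using (ℤ; +_; -_) renaming (_+_ to _+ℤ_)
open import Data.List using (List; []; _∷_; _++_; map; filter; length; allFin; foldr; concatMap)
open import Data.Bool.ListAction using (and)
open import Data.Maybe using (Maybe; just)
open import Data.Product using (Σ; ∃; ∃₂; _×_; _,_)
open import Relation.Nullary using (¬_; does)
open import Relation.Binary.PropositionalEquality using (_≡_; _≢_)

record Graph (n : ℕ) : Set where
  field
    adj    : Fin n → Fin n → Bool
    sym    : ∀ u v → adj u v ≡ adj v u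
    irrefl : ∀ v → adj v v ≡ false
open Graph public

Edge : ∀ {n} → Graph n → Fin n → Fin n → Set
Edge G u v = adj G u v ≡ true

record Orientation {n : ℕ} (G : Graph n) : Set where
  field
    arc      : Fin n → Fin n → Bool
    arc⊆edge : ∀ u v → arc u v ≡ true → Edge G u v
    oneDir   : ∀ u v → Edge G u v → arc u v ≡ not (arc v u)
open Orientation public

Arc : ℕ → Set
Arc n = Fin n × Fin n

arcs : ∀ {n} {G : Graph n} → Orientation G → List (Arc n)
arcs {n} D = concatMap (λ u → concatMap (λ v → if arc D u v then (u , v) ∷ [] else []) (allFin n)) (allFin n)

sublists : ∀ {A : Set} → List A → List (List A)
sublists [] = [] ∷ []
sublists (x ∷ xs) = let r = sublists xs in r ++ map (x ∷_) r

outdegIn : ∀ {n} → List (Arc n) → Fin n → ℕ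
outdegIn F v = length (filter (λ a → Data.Fin.Properties._≟_ (Data.Product.proj₁ a) v) F)

indegIn : ∀ {n} → List (Arc n) → Fin n → ℕ
indegIn F v = length (filter (λ a → Data.Fin.Properties._≟_ (Data.Product.proj₂ a) v) F)

-- F (a set of arcs, spanning) is Eulerian: in-degree = out-degree at every vertex
isEulerian : ∀ {n} → List (Arc n) → Bool
isEulerian {n} F = and (map (λ v → outdegIn F v ≡ᵇ indegIn F v) (allFin n))

sign : ℕ → ℤ
sign zero = + 1
sign (suc k) = - sign k

diff : ∀ {n} {G : Graph n} → Orientation G → ℤ
diff D = foldr (λ F acc → (if isEulerian F then sign (length F) else + 0) +ℤ acc) (+ 0) (sublists (arcs D))

IsATOrientation : ∀ {n} {G : Graph n} → Orientation G → Set
IsATOrientation D = diff D ≢ + 0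

outdeg : ∀ {n} {G : Graph n} → Orientation G → Fin n → ℕ
outdeg D v = outdegIn (arcs D) v

IsFAT : ∀ {n} (G : Graph n) → (Fin n → ℕ) → Set
IsFAT {n} G f = Σ (Orientation G) λ D → IsATOrientation D × (∀ v → outdeg D v ≤ f v ∸ 1)

fxy : ∀ {n} → Fin n → Fin n → ℕ → ℕ → Fin n → ℕ
fxy x y a b v = if does (v ≟F x) then a else (if does (v ≟F y) then b else 3)

ATExtendable : ∀ {n} (G : Graph n) → Fin n → Fin n → ℕ → ℕ → Set
ATExtendable G x y a b = IsFAT G (fxy x y a b)

-- paths in G staying inside the vertex set P (start vertex assumed in P)
data PathIn {n} (G : Graph n) (P : Fin n → Set) : Fin n → Fin n → Set where
  here : ∀ {u} → PathIn G P u u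
  step : ∀ {u w v} → Edge G u w → P w → PathIn G P w v → PathIn G P u v

HasK4Minor : ∀ {n} → Graph n → Set
HasK4Minor {n} G =
  Σ (Fin n → Maybe (Fin 4)) λ β →
    (∀ i → ∃ λ v → β v ≡ just i) ×
    (∀ i u v → β u ≡ just i → β v ≡ just i → PathIn G (λ w → β w ≡ just i) u v) ×
    (∀ i j → i ≢ j → ∃₂ λ u v → β u ≡ just i × β v ≡ just j × Edge G u v)

K4MinorFree : ∀ {n} → Graph n → Set
K4MinorFree G = ¬ HasK4Minor G

-- A homomorphism from the chain of diamonds D_m into G, given by the images
-- u : Fin (suc m) (u_0..u_m), v w : Fin m (v_1..v_m, w_1..w_m; index i stands for i+1).
record DiamondHom {n} (G : Graph n) (m : ℕ) : Set where
  field
    u : Fin (suc m) → Fin n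
    v : Fin m → Fin n
    w : Fin m → Fin n
    e-uv : ∀ i → Edge G (u (inject₁ i)) (v i)
    e-uw : ∀ i → Edge G (u (inject₁ i)) (w i)
    e-vw : ∀ i → Edge G (v i) (w i)
    e-vu : ∀ i → Edge G (v i) (u (fsuc i))
    e-wu : ∀ i → Edge G (w i) (u (fsuc i))
open DiamondHom public

ChainConnected : ∀ {n} → Graph n → Fin n → Fin n → Set
ChainConnected G x y =
  Σ ℕ λ m → Σ (DiamondHom G m) λ φ →
    (∃ λ i → u φ i ≡ x) × (∃ λ j → u φ j ≡ y)

{-# OPTIONS --safe #-}
-- By Alon and Tarsi, diff(D) is up to sign the coefficient of ∏ v^{d⁺(v)} in the graph polynomial ∏ (u − v), so it
-- suffices to find an odd coefficient under the given bounds on the exponents; modulo 2 all signs disappear.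
--
-- A K₄-minor-free graph has, outside any given vertex or edge, a vertex with at most two neighbours, and such a vertex
-- can be deleted as a source.  If no vertex but x and y qualifies, then y has, say, two neighbours a and b.
-- The same fact, applied after suppressing y into an edge ab, gives N(a) = {y, b, d} up to exchanging a and b.  Making y a
-- sink and taking the coefficient of a¹ suppresses a into the edge bd.  If b and d are not adjacent, the claim for (x, y)
-- thus follows from the (2,2)-claim for (x, b) in a minor.  If they are adjacent, then y and d are the ends of a diamond,
-- and (b + d)² = b² + d² over F₂ reduces the claim to the same claim for (x, d).
module Submission where

open import Defs hiding (u; v; w) renaming (sym to adj-sym)
open import Algebra.Bundles using (module CommutativeRing)
open import Data.Bool using (Bool; true; false; not; if_then_else_; T; _xor_)
open import Data.Bool.ListAction using (and)
import Data.Bool.Properties as Bool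
open import Data.Bool.Properties using (xor-assoc; xor-comm; xor-same; xor-identityʳ; xor-∧-commutativeRing)
open import Algebra.Properties.CommutativeSemigroup
  (CommutativeRing.+-commutativeSemigroup xor-∧-commutativeRing) using (interchange)
open import Data.Empty using (⊥; ⊥-elim)
open import Data.Fin using (Fin; zero; suc; fromℕ)
import Data.Fin.Properties as Fin
open import Data.Integer as ℤ using (ℤ; 0ℤ; 1ℤ; +_; _+_; _-_; -_; _*_; ∣_∣)
import Data.Integer.Properties as ℤ
open import Algebra.Properties.AbelianGroup ℤ.+-0-abelianGroup using (∙-cancelʳ)
open import Data.Integer.Tactic.RingSolver using (solve-∀)
open import Data.List using (List; []; _∷_; _++_; map; filter; length; allFin; concatMap; foldr)
open import Data.List.Membership.Propositional using (_∈_; _∉_; find; lose)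
open import Data.List.Membership.Propositional.Properties
  using (∈-++⁺ˡ; ∈-++⁺ʳ; ∈-++⁻; ∈-map⁺; ∈-map⁻; ∈-filter⁺; ∈-filter⁻; ∈-concatMap⁺; ∈-concatMap⁻; ∈-allFin; ∈-∃++)
open import Data.List.Membership.Propositional.Properties.WithK using (unique∧set⇒bag)
open import Data.List.Properties using (length-filter; filter-notAll; filter-accept; filter-reject; filter-none)
open import Data.List.Relation.Binary.BagAndSetEquality using (∼bag⇒↭)
open import Data.List.Relation.Binary.Permutation.Propositional using (_↭_; refl; prep; swap; trans; ↭-sym; ↭⇒↭ₛ)
open import Data.List.Relation.Binary.Permutation.Propositional.Properties
  using (∈-resp-↭; ↭-length; filter-↭; map⁺; ++⁺ʳ; shift; shifts)
open import Data.List.Relation.Binary.Permutation.Setoid.Properties using (Unique-resp-↭)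
open import Data.List.Relation.Binary.Pointwise using (Pointwise; []; _∷_)
open import Data.List.Relation.Unary.All as All using (All; []; _∷_)
import Data.List.Relation.Unary.All.Properties as All
open import Data.List.Relation.Unary.AllPairs as AllPairs using (AllPairs; []; _∷_)
import Data.List.Relation.Unary.AllPairs.Properties as AllPairs
open import Data.List.Relation.Unary.Any as Any using (Any; here; there)
open import Data.List.Relation.Unary.Unique.Propositional using (Unique)
import Data.List.Relation.Unary.Unique.Propositional.Properties as Unique
open import Data.Maybe using (Maybe; just; nothing)
open import Data.Nat as ℕ using (ℕ; zero; suc; s≤s; _≡ᵇ_; _∸_)
import Data.Nat.Properties as ℕ
open import Data.Product as Product using (∃; ∃₂; _×_; _,_; proj₁; proj₂)
open import Data.Product.Properties using (≡-dec)
open import Data.Sum as Sum using (_⊎_; inj₁; inj₂)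
open import Data.Vec using ([]; _∷_; lookup)
open import Function using (_∘_; mk⇔; _⇔_; Equivalence)
open import Relation.Binary.PropositionalEquality as ≡ using (_≡_; _≢_; _≗_; refl; cong; cong₂; sym; subst)
open import Relation.Nullary using (¬_; Dec; yes; no; does; contradiction)
open import Relation.Nullary.Decidable using (¬?; _×-dec_; _⊎-dec_; dec-true; dec-false; does-⇔)

-- Characteristic 2 is what keeps the induction inside graph polynomials. Over the integers the
-- coefficient of a in (a - b)(a - d) is -(b + d), which is no factor of a graph polynomial; modulo
-- 2 it is the factor of the edge bd, so suppression yields the polynomial of a minor. The price is
-- that the claim carried along is the oddness of a coefficient, which is stronger than `diff` being
-- nonzero. The dichotomy is proved in positive form: `Outcome` is either the (2,1)-bound, or an
-- explicit chain together with the (2,2)-bound. Thus in the diamond case each alternative for (x,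
-- d) yields the same alternative for (x, y), the second one with a longer chain. Vertices are
-- deleted by shortening a list of vertices and taking the induced edges. Suppression instead
-- changes the adjacency on the same vertex type, so the induction hypothesis ranges over all
-- K₄-minor-free graphs on `Fin n`.

private variable
  n : ℕ

-- The graph polynomial modulo 2

-- P_G is taken modulo 2: then the direction of an arc and the signs of the
-- orientations are irrelevant.  Integer exponents make dividing by a variable total.
Exponent : ℕ → Set
Exponent n = Fin n → ℤ

δ : Fin n → Exponent n
δ u w = if does (u Fin.≟ w) then 1ℤ else 0ℤ

infixl 6 _⊕_ _⊖_

_⊕_ _⊖_ : Exponent n → Fin n → Exponent n
(m ⊕ u) w = m w + δ u w
(m ⊖ u) w = m w - δ u w

-- The coefficient of ∏ v^(m v) in ∏ (u + v) over F₂, expanded by letting each arc contribute one of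
-- its two ends.
coef : List (Arc n) → Exponent n → Bool
coef []             m = does (Fin.all? (λ v → m v ℤ.≟ 0ℤ))
coef ((u , v) ∷ es) m = coef es (m ⊖ u) xor coef es (m ⊖ v)

δ-self : (u : Fin n) → δ u u ≡ 1ℤ
δ-self u rewrite dec-true (u Fin.≟ u) refl = refl

δ-≢ : {u v : Fin n} → u ≢ v → δ u v ≡ 0ℤ
δ-≢ {u = u} {v} u≢v rewrite dec-false (u Fin.≟ v) u≢v = refl

δ≥0 : (u v : Fin n) → 0ℤ ℤ.≤ δ u v
δ≥0 u v with does (u Fin.≟ v)
... | true  = ℤ.+≤+ ℕ.z≤n
... | false = ℤ.≤-refl

⊖-≤ : (m : Exponent n) (u v : Fin n) → (m ⊖ u) v ℤ.≤ m v
⊖-≤ m u v = subst ((m ⊖ u) v ℤ.≤_) (ℤ.+-identityʳ (m v)) (ℤ.+-monoʳ-≤ (m v) (ℤ.neg-mono-≤ (δ≥0 u v)))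

⊖-mono : {f g : Exponent n} (u : Fin n) → (∀ v → f v ℤ.≤ g v) → ∀ v → (f ⊖ u) v ℤ.≤ (g ⊖ u) v
⊖-mono u f≤g v = ℤ.+-monoˡ-≤ _ (f≤g v)

⊕-⊖ : (m : Exponent n) (u : Fin n) → m ⊕ u ⊖ u ≗ m
⊕-⊖ m u w = lemma (m w) (δ u w)
  where
  lemma : ∀ x d → x + d - d ≡ x
  lemma = solve-∀

⊖-⊕ : (m : Exponent n) (u : Fin n) → m ⊖ u ⊕ u ≗ m
⊖-⊕ m u w = lemma (m w) (δ u w)
  where
  lemma : ∀ x d → x - d + d ≡ x
  lemma = solve-∀

⊖-comm : (m : Exponent n) (u v : Fin n) → m ⊖ u ⊖ v ≗ m ⊖ v ⊖ u
⊖-comm m u v w = lemma (m w) (δ u w) (δ v w)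
  where
  lemma : ∀ x d e → x - d - e ≡ x - e - d
  lemma = solve-∀

≤⊖⇒⊕≤ : {m f : Exponent n} (u : Fin n) → (∀ v → m v ℤ.≤ (f ⊖ u) v) → ∀ v → (m ⊕ u) v ℤ.≤ f v
≤⊖⇒⊕≤ {f = f} u m≤ v = subst (_ ℤ.≤_) (⊖-⊕ f u v) (ℤ.+-monoˡ-≤ (δ u v) (m≤ v))

coef-cong : (es : List (Arc n)) {m m′ : Exponent n} → m ≗ m′ → coef es m ≡ coef es m′
coef-cong [] eq = does-⇔ (mk⇔ (λ z v → ≡.trans (sym (eq v)) (z v)) (λ z v → ≡.trans (eq v) (z v))) (Fin.all? _) (Fin.all? _)
coef-cong ((u , v) ∷ es) eq =
  cong₂ _xor_ (coef-cong es (λ w → cong (_- δ u w) (eq w))) (coef-cong es (λ w → cong (_- δ v w) (eq w)))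

-- Each arc can only lower the exponent still to be produced. This discards the branches in which a
-- vertex contributes beyond its allowance.
coef-negative : (es : List (Arc n)) {m : Exponent n} (v : Fin n) → m v ℤ.< 0ℤ → coef es m ≡ false
coef-negative [] v m<0 = dec-false (Fin.all? _) (λ z → ℤ.<-irrefl (z v) m<0)
coef-negative ((a , b) ∷ es) {m} v m<0 =
  cong₂ _xor_ (coef-negative es v (ℤ.≤-<-trans (⊖-≤ m a v) m<0)) (coef-negative es v (ℤ.≤-<-trans (⊖-≤ m b v) m<0))

infix 4 _∉V_

_∉V_ : Fin n → List (Arc n) → Set
v ∉V es = All (λ e → proj₁ e ≢ v × proj₂ e ≢ v) es

⊖-≢ : (m : Exponent n) {u v : Fin n} → u ≢ v → (m ⊖ u) v ≡ m v
⊖-≢ m {u} {v} u≢v rewrite δ-≢ u≢v = ℤ.+-identityʳ (m v)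

-- The variable v does not occur in the product. This discards the branches in which the arcs
-- outside `es` contribute the wrong power of v.
coef-foreign : {es : List (Arc n)} {m : Exponent n} {v : Fin n} → v ∉V es → m v ≢ 0ℤ → coef es m ≡ false
coef-foreign {v = v} [] m≢0 = dec-false (Fin.all? _) (λ z → m≢0 (z v))
coef-foreign {m = m} ((a≢ , b≢) ∷ ∉es) m≢0 =
  cong₂ _xor_ (coef-foreign ∉es (m≢0 ∘ ≡.trans (sym (⊖-≢ m a≢)))) (coef-foreign ∉es (m≢0 ∘ ≡.trans (sym (⊖-≢ m b≢))))

exponent-foreign : {es : List (Arc n)} {m : Exponent n} {v : Fin n} → v ∉V es → coef es m ≡ true → m v ≡ 0ℤ
exponent-foreign {m = m} {v} ∉es c with m v ℤ.≟ 0ℤ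
... | yes z = z
... | no ¬z = contradiction (≡.trans (sym c) (coef-foreign ∉es ¬z)) (λ ())

infix 4 _≋_

-- Equality of the two products as polynomials over F₂; neither the order nor the direction of the
-- arcs matters for it.
record _≋_ (es es′ : List (Arc n)) : Set where
  constructor same
  field coef-≡ : coef es ≗ coef es′
open _≋_

≋-∷ : ∀ e {es es′ : List (Arc n)} → es ≋ es′ → e ∷ es ≋ e ∷ es′
≋-∷ (u , v) eq = same λ m → cong₂ _xor_ (coef-≡ eq (m ⊖ u)) (coef-≡ eq (m ⊖ v))

≋-++ : ∀ xs {es es′ : List (Arc n)} → es ≋ es′ → xs ++ es ≋ xs ++ es′
≋-++ []       eq = eq
≋-++ (e ∷ xs) eq = ≋-∷ e (≋-++ xs eq)

≋-refl : {es : List (Arc n)} → es ≋ es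
≋-refl = same λ _ → refl

≋-sym : {es es′ : List (Arc n)} → es ≋ es′ → es′ ≋ es
≋-sym eq = same λ m → sym (coef-≡ eq m)

≋-trans : {es es′ es″ : List (Arc n)} → es ≋ es′ → es′ ≋ es″ → es ≋ es″
≋-trans p q = same λ m → ≡.trans (coef-≡ p m) (coef-≡ q m)

≋-flip : ∀ u v (es : List (Arc n)) → (u , v) ∷ es ≋ (v , u) ∷ es
≋-flip u v es = same λ m → xor-comm (coef es (m ⊖ u)) _

≋-swap : ∀ e e′ (es : List (Arc n)) → e ∷ e′ ∷ es ≋ e′ ∷ e ∷ es
≋-swap (a , b) (c , d) es = same λ m →
  ≡.trans (interchange (coef es (m ⊖ a ⊖ c)) (coef es (m ⊖ a ⊖ d)) (coef es (m ⊖ b ⊖ c)) (coef es (m ⊖ b ⊖ d)))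
    (cong₂ _xor_ (cong₂ _xor_ (coef-cong es (⊖-comm m a c)) (coef-cong es (⊖-comm m b c)))
                 (cong₂ _xor_ (coef-cong es (⊖-comm m a d)) (coef-cong es (⊖-comm m b d))))

≋-↭ : {es es′ : List (Arc n)} → es ↭ es′ → es ≋ es′
≋-↭ refl          = ≋-refl
≋-↭ (prep e p)    = ≋-∷ e (≋-↭ p)
≋-↭ (swap e e′ p) = ≋-trans (≋-swap e e′ _) (≋-∷ e′ (≋-∷ e (≋-↭ p)))
≋-↭ (trans p q)   = ≋-trans (≋-↭ p) (≋-↭ q)

-- Some monomial of odd coefficient divides ∏ v^(f v). The exponents become out-degrees, so this f
-- is one less than the function in f-AT.
record Good (es : List (Arc n)) (f : Exponent n) : Set where
  constructor good
  field
    exponent : Exponent n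
    odd      : coef es exponent ≡ true
    bounded  : ∀ v → exponent v ℤ.≤ f v

Good-≋ : {es es′ : List (Arc n)} {f : Exponent n} → es ≋ es′ → Good es f → Good es′ f
Good-≋ eq (good m c m≤) = good m (≡.trans (sym (coef-≡ eq m)) c) m≤

Good-≗ : {es : List (Arc n)} {f g : Exponent n} → f ≗ g → Good es f → Good es g
Good-≗ f≗g (good m c m≤) = good m c λ v → ℤ.≤-trans (m≤ v) (ℤ.≤-reflexive (f≗g v))

Good-weaken : {es : List (Arc n)} {f : Exponent n} (u : Fin n) → Good es (f ⊖ u) → Good es f
Good-weaken {f = f} u (good m c m≤) = good m c λ v → ℤ.≤-trans (m≤ v) (⊖-≤ f u v)

-- A vertex that meets no arc has exponent 0, so its allowance of 2 can be given away.
Good-foreign : {es : List (Arc n)} {f : Exponent n} {v : Fin n} →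
  v ∉V es → f v ≡ + 2 → Good es f → Good es (f ⊖ v ⊖ v)
Good-foreign {f = f} {v} ∉es fv (good m c m≤) = good m c bound
  where
  bound : ∀ w → m w ℤ.≤ (f ⊖ v ⊖ v) w
  bound w with v Fin.≟ w
  ... | yes refl rewrite fv = ℤ.≤-reflexive (exponent-foreign ∉es c)
  ... | no _ = subst (m w ℤ.≤_) (sym (≡.trans (ℤ.+-identityʳ (f w + 0ℤ)) (ℤ.+-identityʳ (f w)))) (m≤ w)

-- As r is absent from `es`, exponent 1 at r can only come from the new arc.
Good-source₁ : {es : List (Arc n)} {f : Exponent n} {r p : Fin n} →
  r ∉V es → p ≢ r → Good es (f ⊖ r) → Good ((r , p) ∷ es) f
Good-source₁ {es = es} {f} {r} {p} ∉es p≢r (good m c m≤) = good (m ⊕ r) coefficient (≤⊖⇒⊕≤ r m≤)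
  where
  mr : m r ≡ 0ℤ
  mr = exponent-foreign ∉es c
  coefficient : coef ((r , p) ∷ es) (m ⊕ r) ≡ true
  coefficient = cong₂ _xor_ (≡.trans (coef-cong es (⊕-⊖ m r)) c) (coef-foreign ∉es nonzero)
    where
    nonzero : (m ⊕ r ⊖ p) r ≢ 0ℤ
    nonzero rewrite mr | δ-self r | δ-≢ p≢r = λ ()

-- Exponent 2 at r forces both new arcs to contribute r.
Good-source₂ : {es : List (Arc n)} {f : Exponent n} {r p q : Fin n} →
  r ∉V es → p ≢ r → q ≢ r → Good es (f ⊖ r ⊖ r) → Good ((r , p) ∷ (r , q) ∷ es) f
Good-source₂ {es = es} {f} {r} {p} {q} ∉es p≢r q≢r (good m c m≤) =
  good (m ⊕ r ⊕ r) coefficient (≤⊖⇒⊕≤ {f = f} r (≤⊖⇒⊕≤ r m≤))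
  where
  mr : m r ≡ 0ℤ
  mr = exponent-foreign ∉es c
  coefficient : coef ((r , p) ∷ (r , q) ∷ es) (m ⊕ r ⊕ r) ≡ true
  coefficient =
    cong₂ _xor_ (cong₂ _xor_ (≡.trans (coef-cong es (λ w → lemma (m w) (δ r w))) c) (coef-foreign ∉es rq))
                (cong₂ _xor_ (coef-foreign ∉es pr) (coef-foreign ∉es pq))
    where
    lemma : ∀ x d → x + d + d - d - d ≡ x
    lemma = solve-∀
    rq : (m ⊕ r ⊕ r ⊖ r ⊖ q) r ≢ 0ℤ
    rq rewrite mr | δ-self r | δ-≢ q≢r = λ ()
    pr : (m ⊕ r ⊕ r ⊖ p ⊖ r) r ≢ 0ℤ
    pr rewrite mr | δ-self r | δ-≢ p≢r = λ ()
    pq : (m ⊕ r ⊕ r ⊖ p ⊖ q) r ≢ 0ℤ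
    pq rewrite mr | δ-self r | δ-≢ p≢r | δ-≢ q≢r = λ ()

-- With no allowance left at y, the arc must contribute w and is charged to the allowance of w.
Good-sink : {es : List (Arc n)} {f : Exponent n} (y w : Fin n) →
  f y ≡ 0ℤ → Good es (f ⊖ w) → Good ((y , w) ∷ es) f
Good-sink {es = es} {f} y w fy (good m c m≤) = good (m ⊕ w) coefficient bound
  where
  bound : ∀ v → (m ⊕ w) v ℤ.≤ f v
  bound = ≤⊖⇒⊕≤ w m≤
  negative : (m ⊕ w ⊖ y) y ℤ.< 0ℤ
  negative rewrite δ-self y =
    ℤ.≤-<-trans (ℤ.+-monoˡ-≤ (- 1ℤ) (subst (_ ℤ.≤_) fy (bound y))) ℤ.-<+
  coefficient : coef ((y , w) ∷ es) (m ⊕ w) ≡ true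
  coefficient = cong₂ _xor_ (coef-negative es y negative) (≡.trans (coef-cong es (⊕-⊖ m w)) c)

-- The coefficient of a in (a + b)(a + d) is b + d modulo 2.
Good-suppress : {es : List (Arc n)} {f : Exponent n} {a b d : Fin n} →
  a ∉V es → b ≢ a → d ≢ a → Good ((b , d) ∷ es) (f ⊖ a) → Good ((a , b) ∷ (a , d) ∷ es) f
Good-suppress {es = es} {f} {a} {b} {d} ∉es b≢a d≢a (good m c m≤) = good (m ⊕ a) coefficient (≤⊖⇒⊕≤ a m≤)
  where
  ma : m a ≡ 0ℤ
  ma = exponent-foreign {m = m} ((b≢a , d≢a) ∷ ∉es) c
  coefficient : coef ((a , b) ∷ (a , d) ∷ es) (m ⊕ a) ≡ true
  coefficient = ≡.trans
    (cong₂ _xor_ (cong₂ _xor_ (coef-foreign ∉es aa) (coef-cong es (λ w → lemma₁ (m w) (δ a w) (δ d w))))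
                 (cong₂ _xor_ (coef-cong es (λ w → lemma₂ (m w) (δ a w) (δ b w))) (coef-foreign ∉es bd)))
    (≡.trans (cong (coef es (m ⊖ d) xor_) (xor-identityʳ (coef es (m ⊖ b)))) (≡.trans (xor-comm (coef es (m ⊖ d)) (coef es (m ⊖ b))) c))
    where
    lemma₁ : ∀ x e g → x + e - e - g ≡ x - g
    lemma₁ = solve-∀
    lemma₂ : ∀ x e g → x + e - g - e ≡ x - g
    lemma₂ = solve-∀
    aa : (m ⊕ a ⊖ a ⊖ a) a ≢ 0ℤ
    aa rewrite ma | δ-self a = λ ()
    bd : (m ⊕ a ⊖ b ⊖ d) a ≢ 0ℤ
    bd rewrite ma | δ-self a | δ-≢ b≢a | δ-≢ d≢a = λ ()

-- (a + b)² = a² + b² over F₂: the two mixed terms coincide and cancel.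
coef-square : (es : List (Arc n)) (a b : Fin n) (m : Exponent n) →
  coef ((a , b) ∷ (a , b) ∷ es) m ≡ coef es (m ⊖ a ⊖ a) xor coef es (m ⊖ b ⊖ b)
coef-square es a b m rewrite coef-cong es (⊖-comm m b a) =
  cancel (coef es (m ⊖ a ⊖ a)) (coef es (m ⊖ a ⊖ b)) (coef es (m ⊖ b ⊖ b))
  where
  cancel : ∀ x y z → (x xor y) xor (y xor z) ≡ x xor z
  cancel x y z = ≡.trans (xor-assoc x y (y xor z))
    (cong (x xor_) (≡.trans (sym (xor-assoc y y z)) (cong (_xor z) (xor-same y))))

-- The coefficient of a² in (a + b)²(a + d) is d modulo 2.
Good-square : {es : List (Arc n)} {f : Exponent n} {a b d : Fin n} →
  a ∉V es → b ≢ a → d ≢ a → Good es (f ⊖ a ⊖ a ⊖ d) → Good ((a , b) ∷ (a , b) ∷ (a , d) ∷ es) f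
Good-square {es = es} {f} {a} {b} {d} ∉es b≢a d≢a (good m c m≤) =
  good M (≡.trans (coef-square ((a , d) ∷ es) a b M) coefficient)
    (≤⊖⇒⊕≤ {f = f} a (≤⊖⇒⊕≤ {f = f ⊖ a} a (≤⊖⇒⊕≤ {f = f ⊖ a ⊖ a} d m≤)))
  where
  M = m ⊕ d ⊕ a ⊕ a
  ma : m a ≡ 0ℤ
  ma = exponent-foreign ∉es c
  coefficient : coef ((a , d) ∷ es) (M ⊖ a ⊖ a) xor coef ((a , d) ∷ es) (M ⊖ b ⊖ b) ≡ true
  coefficient =
    cong₂ _xor_ (cong₂ _xor_ (coef-foreign ∉es aaa) (≡.trans (coef-cong es (λ w → lemma (m w) (δ a w) (δ d w))) c))
                (cong₂ _xor_ (coef-foreign ∉es bba) (coef-foreign ∉es bbd))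
    where
    lemma : ∀ x e g → x + g + e + e - e - e - g ≡ x
    lemma = solve-∀
    aaa : (M ⊖ a ⊖ a ⊖ a) a ≢ 0ℤ
    aaa rewrite ma | δ-self a | δ-≢ d≢a = λ ()
    bba : (M ⊖ b ⊖ b ⊖ a) a ≢ 0ℤ
    bba rewrite ma | δ-self a | δ-≢ b≢a | δ-≢ d≢a = λ ()
    bbd : (M ⊖ b ⊖ b ⊖ d) a ≢ 0ℤ
    bbd rewrite ma | δ-self a | δ-≢ b≢a | δ-≢ d≢a = λ ()

-- Doubling an arc bd raises the exponent of d from 0 to 2 and lowers that of b by 1.
Good-double : {es : List (Arc n)} {f : Exponent n} {b d : Fin n} →
  d ≢ b → f b ℤ.≤ + 2 → f d ≡ + 2 → Good ((b , d) ∷ es) (f ⊖ d ⊖ d) → Good ((b , d) ∷ (b , d) ∷ es) (f ⊖ b)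
Good-double {es = es} {f} {b} {d} d≢b fb fd (good m c m≤) = good M (≡.trans (coef-square es b d M) coefficient) bound
  where
  M = m ⊕ d ⊕ d ⊖ b
  bound : ∀ v → M v ℤ.≤ (f ⊖ b) v
  bound = ⊖-mono {f = m ⊕ d ⊕ d} {g = f} b (≤⊖⇒⊕≤ {f = f} d (≤⊖⇒⊕≤ {f = f ⊖ d} d m≤))
  -- The given monomial has exponent at most 0 at d, so its single arc bd contributes b.
  negative : (m ⊖ d) d ℤ.< 0ℤ
  negative rewrite δ-self d = ℤ.≤-<-trans (ℤ.+-monoˡ-≤ (- 1ℤ) md) ℤ.-<+
    where
    md : m d ℤ.≤ 0ℤ
    md = ℤ.≤-trans (m≤ d) (ℤ.≤-reflexive (lemma fd (δ-self d)))
      where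
      lemma : ∀ {x e} → x ≡ + 2 → e ≡ 1ℤ → x - e - e ≡ 0ℤ
      lemma refl refl = refl
  -- The b² term would leave an exponent of at most 2 - 3 for b in `es`; only the d² term survives.
  negative′ : (M ⊖ b ⊖ b) b ℤ.< 0ℤ
  negative′ rewrite δ-self b | δ-≢ d≢b = lemma (m b) (ℤ.≤-trans (m≤ b) (ℤ.≤-trans (⊖-≤ (f ⊖ d) d b) (ℤ.≤-trans (⊖-≤ f d b) fb)))
    where
    lemma : ∀ x → x ℤ.≤ + 2 → x + 0ℤ + 0ℤ - 1ℤ - 1ℤ - 1ℤ ℤ.< 0ℤ
    lemma x x≤ rewrite ℤ.+-identityʳ x | ℤ.+-identityʳ x =
      ℤ.≤-<-trans (ℤ.+-monoˡ-≤ _ (ℤ.+-monoˡ-≤ _ (ℤ.+-monoˡ-≤ _ x≤))) ℤ.-<+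
  coefficient : coef es (M ⊖ b ⊖ b) xor coef es (M ⊖ d ⊖ d) ≡ true
  coefficient = cong₂ _xor_ (coef-negative es b negative′)
    (≡.trans (coef-cong es (λ w → lemma (m w) (δ b w) (δ d w)))
      (≡.trans (sym (xor-identityʳ (coef es (m ⊖ b)))) (≡.trans (cong (coef es (m ⊖ b) xor_) (sym (coef-negative es d negative))) c)))
    where
    lemma : ∀ x e g → x + g + g - e - g - g ≡ x - e
    lemma = solve-∀

-- Vertices of degree at most 2 in K₄-minor-free graphs

from-does : ∀ {P : Set} (P? : Dec P) → does P? ≡ true → P
from-does (yes p) _ = p

infix 4 _∈?_

_∈?_ : (v : Fin n) (A : List (Fin n)) → Dec (v ∈ A)
v ∈? A = Any.any? (v Fin.≟_) A

Disjoint : List (Fin n) → List (Fin n) → Set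
Disjoint A B = ∀ {v} → v ∈ A → v ∈ B → ⊥

infixl 6 _∖_

_∖_ : List (Fin n) → Fin n → List (Fin n)
R ∖ v = filter (λ w → ¬? (w Fin.≟ v)) R

∈-∖⁺ : {R : List (Fin n)} {v w : Fin n} → w ∈ R → w ≢ v → w ∈ R ∖ v
∈-∖⁺ {v = v} = ∈-filter⁺ (λ w → ¬? (w Fin.≟ v))

∈-∖⁻ : {R : List (Fin n)} {v w : Fin n} → w ∈ R ∖ v → w ∈ R × w ≢ v
∈-∖⁻ {v = v} = ∈-filter⁻ (λ w → ¬? (w Fin.≟ v))

shorter-∖ : {R : List (Fin n)} {v : Fin n} {k : ℕ} → v ∈ R → length R ℕ.≤ suc k → length (R ∖ v) ℕ.≤ k
shorter-∖ {R = R} {v} v∈ len = ℕ.≤-pred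
  (ℕ.≤-trans (filter-notAll (λ w → ¬? (w Fin.≟ v)) R (Any.map (λ v≡w w≢v → w≢v (sym v≡w)) v∈)) len)

-- A vertex of the graph in which A is contracted to `left` and B to `right`.
data Blob (n : ℕ) : Set where
  left right : Blob n
  pt : Fin n → Blob n

infix 4 _∈[_,_]_

_∈[_,_]_ : Fin n → List (Fin n) → List (Fin n) → Blob n → Set
v ∈[ A , B ] left  = v ∈ A
v ∈[ A , B ] right = v ∈ B
v ∈[ A , B ] pt p  = v ≡ p

-- A branch set is inhabited because it is adjacent to another one; this names the other one.
another : (i : Fin 4) → ∃ λ j → i ≢ j
another zero    = suc zero , λ ()
another (suc _) = zero , λ ()

module _ (G : Graph n) where

  edge? : (u v : Fin n) → Dec (Edge G u v)
  edge? u v = adj G u v Bool.≟ true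

  edge-sym : {u v : Fin n} → Edge G u v → Edge G v u
  edge-sym {u} {v} e = ≡.trans (adj-sym G v u) e

  edge-≢ : {u v : Fin n} → Edge G u v → u ≢ v
  edge-≢ {u} e refl with ≡.trans (sym e) (irrefl G u)
  ... | ()

  path-trans : {P : Fin n → Set} {u v w : Fin n} → PathIn G P u v → PathIn G P v w → PathIn G P u w
  path-trans here         q = q
  path-trans (step e p r) q = step e p (path-trans r q)

  path-mono : {P Q : Fin n → Set} → (∀ {w} → P w → Q w) → {u v : Fin n} → PathIn G P u v → PathIn G Q u v
  path-mono i here         = here
  path-mono i (step e p r) = step e (i p) (path-mono i r)

  Connected : List (Fin n) → Set
  Connected A = ∀ {u v} → u ∈ A → v ∈ A → PathIn G (_∈ A) u v

  Adjacent : List (Fin n) → List (Fin n) → Set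
  Adjacent A B = Any (λ u → Any (Edge G u) B) A

  adjacent? : ∀ A B → Dec (Adjacent A B)
  adjacent? A B = Any.any? (λ u → Any.any? (edge? u) B) A

  adjacent : ∀ {A B u v} → u ∈ A → v ∈ B → Edge G u v → Adjacent A B
  adjacent u∈ v∈ e = lose u∈ (lose v∈ e)

  adjacent⁻ : ∀ {A B} → Adjacent A B → ∃₂ λ u v → u ∈ A × v ∈ B × Edge G u v
  adjacent⁻ a with find a
  ... | u , u∈ , b with find b
  ... | v , v∈ , e = u , v , u∈ , v∈ , e

  adjacent-sym : ∀ {A B} → Adjacent A B → Adjacent B A
  adjacent-sym a with adjacent⁻ a
  ... | u , v , u∈ , v∈ , e = adjacent v∈ u∈ (edge-sym e)

  connected-[_] : ∀ v → Connected (v ∷ [])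
  connected-[ v ] (here refl) (here refl) = here

  connected-∷ : ∀ {v A} → Connected A → Adjacent (v ∷ []) A → Connected (v ∷ A)
  connected-∷ {v} {A} cA a = go
    where
    hub : ∃ λ d → d ∈ A × Edge G v d
    hub with adjacent⁻ a
    ... | _ , d , here refl , d∈ , e = d , d∈ , e
    go : Connected (v ∷ A)
    go (here refl) (here refl) = here
    go (here refl) (there w) = step (proj₂ (proj₂ hub)) (there (proj₁ (proj₂ hub))) (path-mono there (cA (proj₁ (proj₂ hub)) w))
    go (there u) (here refl) = path-trans (path-mono there (cA u (proj₁ (proj₂ hub)))) (step (edge-sym (proj₂ (proj₂ hub))) (here refl) here)
    go (there u) (there w) = path-mono there (cA u w)

  -- An empty B means that only A is contracted; this covers the exclusion of a single vertex.
  Link : List (Fin n) → List (Fin n) → Set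
  Link A B = Adjacent A B ⊎ B ≡ []

  -- A set adjacent to B shows that B is not empty, so the link is an adjacency.
  link-adjacent : ∀ {A B C} → Link A B → Adjacent C B → Adjacent A B
  link-adjacent (inj₁ a)    _ = a
  link-adjacent (inj₂ refl) a with adjacent⁻ a
  ... | _ , _ , _ , () , _

  connected-++ : ∀ {A B} → Connected A → Connected B → Link A B → Connected (A ++ B)
  connected-++ {A} {B} cA cB link u∈ v∈ with ∈-++⁻ A u∈ | ∈-++⁻ A v∈ | link
  ... | inj₁ u | inj₁ v | _ = path-mono ∈-++⁺ˡ (cA u v)
  ... | inj₂ u | inj₂ v | _ = path-mono (∈-++⁺ʳ A) (cB u v)
  ... | inj₂ () | inj₁ _ | inj₂ refl
  ... | inj₁ _ | inj₂ () | inj₂ refl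
  ... | inj₁ u | inj₂ v | inj₁ a with adjacent⁻ a
  ...   | a , b , a∈ , b∈ , e =
    path-trans (path-mono ∈-++⁺ˡ (cA u a∈)) (step e (∈-++⁺ʳ A b∈) (path-mono (∈-++⁺ʳ A) (cB b∈ v)))
  connected-++ {A} {B} cA cB link u∈ v∈ | inj₂ u | inj₁ v | inj₁ a with adjacent⁻ a
  ...   | a , b , a∈ , b∈ , e =
    path-trans (path-mono (∈-++⁺ʳ A) (cB u b∈)) (step (edge-sym e) (∈-++⁺ˡ a∈) (path-mono ∈-++⁺ˡ (cA a∈ v)))

  k4-minor : (blob : Fin 4 → List (Fin n)) → (∀ i → Connected (blob i)) →
    (∀ i j {v} → v ∈ blob i → v ∈ blob j → i ≡ j) → (∀ i j → i ≢ j → Adjacent (blob i) (blob j)) → HasK4Minor G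
  k4-minor blob conn disjoint adjacency = β , inhabited , connectivity , edges
    where
    β : Fin n → Maybe (Fin 4)
    β v with Fin.any? (λ i → v ∈? blob i)
    ... | yes (i , _) = just i
    ... | no _        = nothing
    ∈⇒β : ∀ {i v} → v ∈ blob i → β v ≡ just i
    ∈⇒β {i} {v} v∈ with Fin.any? (λ i → v ∈? blob i)
    ... | yes (j , v∈′) = cong just (disjoint j i v∈′ v∈)
    ... | no ¬∈ = contradiction (i , v∈) ¬∈
    β⇒∈ : ∀ {i v} → β v ≡ just i → v ∈ blob i
    β⇒∈ {i} {v} eq with Fin.any? (λ i → v ∈? blob i)
    β⇒∈ refl | yes (j , v∈) = v∈
    edges : ∀ i j → i ≢ j → ∃₂ λ u v → β u ≡ just i × β v ≡ just j × Edge G u v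
    edges i j i≢j with adjacent⁻ (adjacency i j i≢j)
    ... | u , v , u∈ , v∈ , e = u , v , ∈⇒β u∈ , ∈⇒β v∈ , e
    inhabited : ∀ i → ∃ λ v → β v ≡ just i
    inhabited i with edges i (proj₁ (another i)) (proj₂ (another i))
    ... | u , _ , eq , _ = u , eq
    connectivity : ∀ i u v → β u ≡ just i → β v ≡ just i → PathIn G (λ w → β w ≡ just i) u v
    connectivity i u v eq eq′ = path-mono ∈⇒β (conn i (β⇒∈ eq) (β⇒∈ eq′))

  k4-minor-of-four : ∀ {A B C D} → Connected A → Connected B → Connected C → Connected D →
    Disjoint A B → Disjoint A C → Disjoint A D → Disjoint B C → Disjoint B D → Disjoint C D →
    Adjacent A B → Adjacent A C → Adjacent A D → Adjacent B C → Adjacent B D → Adjacent C D → HasK4Minor G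
  k4-minor-of-four {A} {B} {C} {D} cA cB cC cD ab ac ad bc bd cd eab eac ead ebc ebd ecd =
    k4-minor blob conn disjoint adjacency
    where
    blob : Fin 4 → List (Fin n)
    blob = lookup (A ∷ B ∷ C ∷ D ∷ [])
    conn : ∀ i → Connected (blob i)
    conn zero                = cA
    conn (suc zero)          = cB
    conn (suc (suc zero))    = cC
    conn (suc (suc (suc zero))) = cD
    disjoint : ∀ i j {v} → v ∈ blob i → v ∈ blob j → i ≡ j
    disjoint zero zero p q = refl
    disjoint zero (suc zero) p q = ⊥-elim (ab p q)
    disjoint zero (suc (suc zero)) p q = ⊥-elim (ac p q)
    disjoint zero (suc (suc (suc zero))) p q = ⊥-elim (ad p q)
    disjoint (suc zero) zero p q = ⊥-elim (ab q p)
    disjoint (suc zero) (suc zero) p q = refl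
    disjoint (suc zero) (suc (suc zero)) p q = ⊥-elim (bc p q)
    disjoint (suc zero) (suc (suc (suc zero))) p q = ⊥-elim (bd p q)
    disjoint (suc (suc zero)) zero p q = ⊥-elim (ac q p)
    disjoint (suc (suc zero)) (suc zero) p q = ⊥-elim (bc q p)
    disjoint (suc (suc zero)) (suc (suc zero)) p q = refl
    disjoint (suc (suc zero)) (suc (suc (suc zero))) p q = ⊥-elim (cd p q)
    disjoint (suc (suc (suc zero))) zero p q = ⊥-elim (ad q p)
    disjoint (suc (suc (suc zero))) (suc zero) p q = ⊥-elim (bd q p)
    disjoint (suc (suc (suc zero))) (suc (suc zero)) p q = ⊥-elim (cd q p)
    disjoint (suc (suc (suc zero))) (suc (suc (suc zero))) p q = refl
    adjacency : ∀ i j → i ≢ j → Adjacent (blob i) (blob j)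
    adjacency zero zero ne = ⊥-elim (ne refl)
    adjacency zero (suc zero) ne = eab
    adjacency zero (suc (suc zero)) ne = eac
    adjacency zero (suc (suc (suc zero))) ne = ead
    adjacency (suc zero) zero ne = adjacent-sym eab
    adjacency (suc zero) (suc zero) ne = ⊥-elim (ne refl)
    adjacency (suc zero) (suc (suc zero)) ne = ebc
    adjacency (suc zero) (suc (suc (suc zero))) ne = ebd
    adjacency (suc (suc zero)) zero ne = adjacent-sym eac
    adjacency (suc (suc zero)) (suc zero) ne = adjacent-sym ebc
    adjacency (suc (suc zero)) (suc (suc zero)) ne = ⊥-elim (ne refl)
    adjacency (suc (suc zero)) (suc (suc (suc zero))) ne = ecd
    adjacency (suc (suc (suc zero))) zero ne = adjacent-sym ead
    adjacency (suc (suc (suc zero))) (suc zero) ne = adjacent-sym ebd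
    adjacency (suc (suc (suc zero))) (suc (suc zero)) ne = adjacent-sym ecd
    adjacency (suc (suc (suc zero))) (suc (suc (suc zero))) ne = ⊥-elim (ne refl)

  record Component (D R : List (Fin n)) : Set where
    field
      members   : List (Fin n)
      connected : Connected members
      extends   : ∀ {v} → v ∈ D → v ∈ members
      within    : ∀ {v} → v ∈ members → v ∈ D ⊎ v ∈ R
      closed    : ∀ {u v} → u ∈ members → v ∈ R → Edge G u v → v ∈ members
  open Component

  -- Neighbours are moved from R to D one at a time until R has none left; k bounds the size of R.
  component : ∀ k D R → length R ℕ.≤ k → Connected D → Component D R
  component k D R len cD with adjacent? R D
  component zero D [] len cD | yes ()
  component zero D (_ ∷ _) () cD | yes _
  component k D R len cD | no ¬a = record
    { members = D ; connected = cD ; extends = λ v∈ → v∈ ; within = inj₁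
    ; closed = λ u∈ v∈ e → contradiction (adjacent v∈ u∈ (edge-sym e)) ¬a }
  component (suc k) D R len cD | yes a with adjacent⁻ a
  ... | v , d , v∈ , d∈ , e = record
    { members = members C ; connected = connected C ; extends = extends C ∘ there
    ; within = within′ ∘ within C ; closed = closed′ }
    where
    C : Component (v ∷ D) (R ∖ v)
    C = component k (v ∷ D) (R ∖ v) (shorter-∖ v∈ len) (connected-∷ cD (adjacent (here refl) d∈ e))
    within′ : ∀ {w} → w ∈ v ∷ D ⊎ w ∈ R ∖ v → w ∈ D ⊎ w ∈ R
    within′ (inj₁ (here refl)) = inj₂ v∈
    within′ (inj₁ (there w∈))  = inj₁ w∈
    within′ (inj₂ w∈)          = inj₂ (proj₁ (∈-∖⁻ w∈))
    closed′ : ∀ {u w} → u ∈ members C → w ∈ R → Edge G u w → w ∈ members C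
    closed′ {w = w} u∈ w∈ e with w Fin.≟ v
    ... | yes refl = extends C (here refl)
    ... | no w≢v   = closed C u∈ (∈-∖⁺ w∈ w≢v) e

  -- r has degree at most 2 in the graph on A ∪ B ∪ R with A and B contracted.
  LowDegree : (A B R : List (Fin n)) → Fin n → Set
  LowDegree A B R r = ∃₂ λ p q → ∀ {u} → u ∈ A ⊎ u ∈ B ⊎ u ∈ R → Edge G r u → u ∈[ A , B ] p ⊎ u ∈[ A , B ] q

  -- Carries low degree back from a recursive instance: `inside` says that no neighbour of r was
  -- lost, `conv` renames the contracted vertices.
  transport : ∀ {A B R A′ B′ R′ r} → LowDegree A′ B′ R′ r →
    (∀ {u} → u ∈ A ⊎ u ∈ B ⊎ u ∈ R → Edge G r u → u ∈ A′ ⊎ u ∈ B′ ⊎ u ∈ R′) →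
    (conv : Blob n → Blob n) → (∀ b {u} → Edge G r u → u ∈[ A′ , B′ ] b → u ∈[ A , B ] conv b) →
    LowDegree A B R r
  transport (p , q , cover) inside conv convert = conv p , conv q , λ u∈ e → case′ e (cover (inside u∈ e) e)
    where
    case′ : ∀ {u} → Edge G _ u → _ ⊎ _ → _ ⊎ _
    case′ e (inj₁ u∈p) = inj₁ (convert p e u∈p)
    case′ e (inj₂ u∈q) = inj₂ (convert q e u∈q)

  -- Induction on the size of R; the excluded vertices are connected sets so that the excluded pair
  -- can change. If some c in R sees both A and B, a component of R minus c misses one of A, B, c,
  -- and the other two form the new pair. If no vertex sees both but c sees one of them, the new
  -- pair is A ∪ B and c. If no vertex sees either, any s in R is excluded alone.
  low-degree : K4MinorFree G → ∀ k A B R → length R ℕ.≤ k → Connected A → Connected B → Link A B →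
    Disjoint A B → Disjoint A R → Disjoint B R → ∀ {s} → s ∈ R → ∃ λ r → r ∈ R × LowDegree A B R r
  low-degree free zero A B [] len cA cB link AB AR BR ()
  low-degree free zero A B (_ ∷ _) () cA cB link AB AR BR s∈
  low-degree free (suc k) A B R len cA cB link AB AR BR {s} s∈
    with Any.any? (λ c → adjacent? (c ∷ []) A ×-dec adjacent? (c ∷ []) B) R
  ... | yes both with find both
  ...   | c , c∈ , ca , cb = case-both
    where
    case-both : ∃ λ r → r ∈ R × LowDegree A B R r
    case-both with R ∖ c in eq
    ... | [] = c , c∈ , left , right , cover
      where
      cover : ∀ {u} → u ∈ A ⊎ u ∈ B ⊎ u ∈ R → Edge G c u → u ∈ A ⊎ u ∈ B
      cover (inj₁ u∈) _ = inj₁ u∈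
      cover (inj₂ (inj₁ u∈)) _ = inj₂ u∈
      cover (inj₂ (inj₂ u∈)) e with subst (_ ∈_) eq (∈-∖⁺ u∈ (edge-≢ e ∘ sym))
      ... | ()
    ... | d ∷ _ = separated
      where
      d∈ : d ∈ R ∖ c
      d∈ = subst (d ∈_) (sym eq) (here refl)
      C : Component (d ∷ []) (R ∖ c)
      C = component _ (d ∷ []) (R ∖ c) ℕ.≤-refl connected-[ d ]
      E = members C
      E⊆ : ∀ {v} → v ∈ E → v ∈ R ∖ c
      E⊆ v∈ with within C v∈
      ... | inj₁ (here refl) = d∈
      ... | inj₂ v∈′ = v∈′
      D = filter (_∈? E) (R ∖ c)
      D-short : length D ℕ.≤ k
      D-short = ℕ.≤-trans (length-filter (_∈? E) (R ∖ c)) (shorter-∖ c∈ len)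
      D⁻ : ∀ {v} → v ∈ D → v ∈ E × v ∈ R × v ≢ c
      D⁻ v∈ = proj₂ (∈-filter⁻ (_∈? E) {xs = R ∖ c} v∈) , ∈-∖⁻ (proj₁ (∈-filter⁻ (_∈? E) {xs = R ∖ c} v∈))
      d∈D : d ∈ D
      d∈D = ∈-filter⁺ (_∈? E) d∈ (extends C (here refl))
      closed′ : ∀ {r u} → r ∈ D → u ∈ R → u ≢ c → Edge G r u → u ∈ D
      closed′ r∈ u∈ u≢c e = ∈-filter⁺ (_∈? E) (∈-∖⁺ u∈ u≢c) (closed C (proj₁ (D⁻ r∈)) (∈-∖⁺ u∈ u≢c) e)
      -- A, B, c and the component E would be a K₄ minor, so E is not adjacent to one of the first three.
      separated : ∃ λ r → r ∈ R × LowDegree A B R r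
      separated with adjacent? E A | adjacent? E B | adjacent? E (c ∷ [])
      ... | yes ea | yes eb | yes ec = contradiction
        (k4-minor-of-four cA cB connected-[ c ] (connected C) AB
          (λ { v∈ (here refl) → AR v∈ c∈ }) (λ v∈ v∈E → AR v∈ (proj₁ (∈-∖⁻ (E⊆ v∈E))))
          (λ { v∈ (here refl) → BR v∈ c∈ }) (λ v∈ v∈E → BR v∈ (proj₁ (∈-∖⁻ (E⊆ v∈E))))
          (λ { (here refl) v∈E → proj₂ (∈-∖⁻ {R = R} (E⊆ v∈E)) refl })
          (link-adjacent link cb) (adjacent-sym ca) (adjacent-sym ea) (adjacent-sym cb) (adjacent-sym eb) (adjacent-sym ec))
        free
      ... | _ | _ | no ¬ec with low-degree free k A B D D-short cA cB link AB
              (λ v∈ v∈D → AR v∈ (proj₁ (proj₂ (D⁻ v∈D)))) (λ v∈ v∈D → BR v∈ (proj₁ (proj₂ (D⁻ v∈D)))) d∈D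
      ...   | r , r∈ , low = r , proj₁ (proj₂ (D⁻ r∈)) , transport low inside (λ b → b) (λ { left _ u∈ → u∈ ; right _ u∈ → u∈ ; (pt _) _ u∈ → u∈ })
        where
        inside : ∀ {u} → u ∈ A ⊎ u ∈ B ⊎ u ∈ R → Edge G r u → u ∈ A ⊎ u ∈ B ⊎ u ∈ D
        inside (inj₁ u∈) e = inj₁ u∈
        inside (inj₂ (inj₁ u∈)) e = inj₂ (inj₁ u∈)
        inside {u} (inj₂ (inj₂ u∈)) e with u Fin.≟ c
        ... | yes refl = contradiction (adjacent (proj₁ (D⁻ r∈)) (here refl) e) ¬ec
        ... | no u≢c   = inj₂ (inj₂ (closed′ r∈ u∈ u≢c e))
      separated | no ¬ea | _ | yes _ with low-degree free k (c ∷ []) B D D-short connected-[ c ] cB (inj₁ cb)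
              (λ { (here refl) v∈ → BR v∈ c∈ }) (λ { (here refl) v∈D → proj₂ (proj₂ (D⁻ v∈D)) refl })
              (λ v∈ v∈D → BR v∈ (proj₁ (proj₂ (D⁻ v∈D)))) d∈D
      ...   | r , r∈ , low = r , proj₁ (proj₂ (D⁻ r∈)) , transport low inside
                (λ { left → pt c ; right → right ; (pt v) → pt v })
                (λ { left _ (here refl) → refl ; right _ u∈ → u∈ ; (pt _) _ u∈ → u∈ })
        where
        inside : ∀ {u} → u ∈ A ⊎ u ∈ B ⊎ u ∈ R → Edge G r u → u ∈ c ∷ [] ⊎ u ∈ B ⊎ u ∈ D
        inside (inj₁ u∈) e = contradiction (adjacent (proj₁ (D⁻ r∈)) u∈ e) ¬ea
        inside (inj₂ (inj₁ u∈)) e = inj₂ (inj₁ u∈)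
        inside {u} (inj₂ (inj₂ u∈)) e with u Fin.≟ c
        ... | yes refl = inj₁ (here refl)
        ... | no u≢c   = inj₂ (inj₂ (closed′ r∈ u∈ u≢c e))
      separated | yes _ | no ¬eb | yes _ with low-degree free k A (c ∷ []) D D-short cA connected-[ c ] (inj₁ (adjacent-sym ca))
              (λ { v∈ (here refl) → AR v∈ c∈ }) (λ v∈ v∈D → AR v∈ (proj₁ (proj₂ (D⁻ v∈D))))
              (λ { (here refl) v∈D → proj₂ (proj₂ (D⁻ v∈D)) refl }) d∈D
      ...   | r , r∈ , low = r , proj₁ (proj₂ (D⁻ r∈)) , transport low inside
                (λ { left → left ; right → pt c ; (pt v) → pt v })
                (λ { left _ u∈ → u∈ ; right _ (here refl) → refl ; (pt _) _ u∈ → u∈ })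
        where
        inside : ∀ {u} → u ∈ A ⊎ u ∈ B ⊎ u ∈ R → Edge G r u → u ∈ A ⊎ u ∈ c ∷ [] ⊎ u ∈ D
        inside (inj₁ u∈) e = inj₁ u∈
        inside (inj₂ (inj₁ u∈)) e = contradiction (adjacent (proj₁ (D⁻ r∈)) u∈ e) ¬eb
        inside {u} (inj₂ (inj₂ u∈)) e with u Fin.≟ c
        ... | yes refl = inj₂ (inj₁ (here refl))
        ... | no u≢c   = inj₂ (inj₂ (closed′ r∈ u∈ u≢c e))
  low-degree free (suc k) A B R len cA cB link AB AR BR {s} s∈ | no ¬both with adjacent? R (A ++ B)
  ... | yes a with adjacent⁻ a
  ...   | c , w , c∈ , w∈ , cw = merged
    where
    -- No vertex of R sees both A and B, so contracting A ∪ B to one vertex preserves degrees.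
    side : ∀ {r} → r ∈ R → ∃ λ b → ∀ {u} → Edge G r u → u ∈ A ++ B → u ∈[ A , B ] b
    side {r} r∈ with adjacent? (r ∷ []) A
    ... | yes ra = left , λ e u∈ → go e (∈-++⁻ A u∈)
      where
      go : ∀ {u} → Edge G r u → u ∈ A ⊎ u ∈ B → u ∈ A
      go e (inj₁ u∈) = u∈
      go e (inj₂ u∈) = contradiction (lose r∈ (ra , adjacent (here refl) u∈ e)) ¬both
    ... | no ¬ra = right , λ e u∈ → go e (∈-++⁻ A u∈)
      where
      go : ∀ {u} → Edge G r u → u ∈ A ⊎ u ∈ B → u ∈ B
      go e (inj₁ u∈) = contradiction (adjacent (here refl) u∈ e) ¬ra
      go e (inj₂ u∈) = u∈
    merged : ∃ λ r → r ∈ R × LowDegree A B R r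
    merged with R ∖ c in eq
    ... | [] = c , c∈ , b , b , cover
      where
      b = proj₁ (side c∈)
      cover : ∀ {u} → u ∈ A ⊎ u ∈ B ⊎ u ∈ R → Edge G c u → u ∈[ A , B ] b ⊎ u ∈[ A , B ] b
      cover (inj₁ u∈) e = inj₁ (proj₂ (side c∈) e (∈-++⁺ˡ u∈))
      cover (inj₂ (inj₁ u∈)) e = inj₁ (proj₂ (side c∈) e (∈-++⁺ʳ A u∈))
      cover (inj₂ (inj₂ u∈)) e with subst (_ ∈_) eq (∈-∖⁺ u∈ (edge-≢ e ∘ sym))
      ... | ()
    ... | d ∷ _ with low-degree free k (A ++ B) (c ∷ []) (R ∖ c) (shorter-∖ c∈ len)
                  (connected-++ cA cB link) connected-[ c ] (inj₁ (adjacent w∈ (here refl) (edge-sym cw)))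
                  (λ { v∈ (here refl) → AB-R v∈ c∈ }) (λ v∈ v∈R → AB-R v∈ (proj₁ (∈-∖⁻ v∈R)))
                  (λ { (here refl) v∈R → proj₂ (∈-∖⁻ {R = R} v∈R) refl }) (subst (d ∈_) (sym eq) (here refl))
      where
      AB-R : Disjoint (A ++ B) R
      AB-R v∈ v∈R with ∈-++⁻ A v∈
      ... | inj₁ v∈A = AR v∈A v∈R
      ... | inj₂ v∈B = BR v∈B v∈R
    ...   | r , r∈ , low = r , r∈R , transport low inside
              (λ { left → proj₁ (side r∈R) ; right → pt c ; (pt v) → pt v })
              (λ { left e u∈ → proj₂ (side r∈R) e u∈ ; right _ (here refl) → refl ; (pt _) _ u∈ → u∈ })
      where
      r∈R : r ∈ R
      r∈R = proj₁ (∈-∖⁻ r∈)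
      inside : ∀ {u} → u ∈ A ⊎ u ∈ B ⊎ u ∈ R → Edge G r u → u ∈ A ++ B ⊎ u ∈ c ∷ [] ⊎ u ∈ R ∖ c
      inside (inj₁ u∈) e = inj₁ (∈-++⁺ˡ u∈)
      inside (inj₂ (inj₁ u∈)) e = inj₁ (∈-++⁺ʳ A u∈)
      inside {u} (inj₂ (inj₂ u∈)) e with u Fin.≟ c
      ... | yes refl = inj₂ (inj₁ (here refl))
      ... | no u≢c   = inj₂ (inj₂ (∈-∖⁺ u∈ u≢c))
  low-degree free (suc k) A B R len cA cB link AB AR BR {s} s∈ | no ¬both | no ¬a = detached
    where
    absent : ∀ {r u} → r ∈ R → u ∈ A ++ B → Edge G r u → ⊥
    absent r∈ u∈ e = ¬a (adjacent r∈ u∈ e)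
    detached : ∃ λ r → r ∈ R × LowDegree A B R r
    detached with R ∖ s in eq
    ... | [] = s , s∈ , left , left , cover
      where
      cover : ∀ {u} → u ∈ A ⊎ u ∈ B ⊎ u ∈ R → Edge G s u → u ∈ A ⊎ u ∈ A
      cover (inj₁ u∈) e = inj₁ u∈
      cover (inj₂ (inj₁ u∈)) e = ⊥-elim (absent s∈ (∈-++⁺ʳ A u∈) e)
      cover (inj₂ (inj₂ u∈)) e with subst (_ ∈_) eq (∈-∖⁺ u∈ (edge-≢ e ∘ sym))
      ... | ()
    ... | d ∷ _ with low-degree free k (s ∷ []) [] (R ∖ s) (shorter-∖ s∈ len)
                  connected-[ s ] (λ ()) (inj₂ refl) (λ _ ()) (λ { (here refl) v∈R → proj₂ (∈-∖⁻ {R = R} v∈R) refl }) (λ ())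
                  (subst (d ∈_) (sym eq) (here refl))
    ...   | r , r∈ , low = r , r∈R , transport low inside
              (λ { left → pt s ; right → left ; (pt v) → pt v })
              (λ { left _ (here refl) → refl ; right _ () ; (pt _) _ u∈ → u∈ })
      where
      r∈R : r ∈ R
      r∈R = proj₁ (∈-∖⁻ r∈)
      inside : ∀ {u} → u ∈ A ⊎ u ∈ B ⊎ u ∈ R → Edge G r u → u ∈ s ∷ [] ⊎ u ∈ [] ⊎ u ∈ R ∖ s
      inside (inj₁ u∈) e = ⊥-elim (absent r∈R (∈-++⁺ˡ u∈) e)
      inside (inj₂ (inj₁ u∈)) e = ⊥-elim (absent r∈R (∈-++⁺ʳ A u∈) e)
      inside {u} (inj₂ (inj₂ u∈)) e with u Fin.≟ s
      ... | yes refl = inj₁ (here refl)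
      ... | no u≢s   = inj₂ (inj₂ (∈-∖⁺ u∈ u≢s))

  -- p and q may coincide and need not be neighbours of r, so this is degree at most 2 in the graph
  -- induced by S.
  TwoNeighbours : List (Fin n) → Fin n → Set
  TwoNeighbours S r = ∃₂ λ p q → ∀ {u} → u ∈ S → Edge G r u → u ≡ p ⊎ u ≡ q

  private
    endpoint : Fin n → Fin n → Blob n → Fin n
    endpoint x y left   = x
    endpoint x y right  = y
    endpoint x y (pt p) = p

  dirac₂ : K4MinorFree G → ∀ {x y R s} → Edge G x y → x ∉ R → y ∉ R → s ∈ R →
    ∃ λ r → r ∈ R × TwoNeighbours (x ∷ y ∷ R) r
  dirac₂ free {x} {y} {R} e x∉ y∉ s∈
    with low-degree free _ (x ∷ []) (y ∷ []) R ℕ.≤-refl connected-[ x ] connected-[ y ]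
           (inj₁ (adjacent (here refl) (here refl) e)) (λ { (here refl) (here refl) → edge-≢ e refl })
           (λ { (here refl) → x∉ }) (λ { (here refl) → y∉ }) s∈
  ... | r , r∈ , p , q , cover = r , r∈ , endpoint x y p , endpoint x y q , two
    where
    convert : ∀ b {u} → u ∈[ x ∷ [] , y ∷ [] ] b → u ≡ endpoint x y b
    convert left   (here refl) = refl
    convert right  (here refl) = refl
    convert (pt p) eq          = eq
    locate : ∀ {u} → u ∈ x ∷ y ∷ R → u ∈ x ∷ [] ⊎ u ∈ y ∷ [] ⊎ u ∈ R
    locate (here eq)         = inj₁ (here eq)
    locate (there (here eq)) = inj₂ (inj₁ (here eq))
    locate (there (there i)) = inj₂ (inj₂ i)
    two : ∀ {u} → u ∈ x ∷ y ∷ R → Edge G r u → u ≡ endpoint x y p ⊎ u ≡ endpoint x y q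
    two u∈ e with cover (locate u∈) e
    ... | inj₁ i = inj₁ (convert p i)
    ... | inj₂ i = inj₂ (convert q i)

  -- Here A is {x} and B is empty; `right` then contains no vertex and may be given the name x.
  dirac₁ : K4MinorFree G → ∀ x {S s} → s ∈ S → s ≢ x → ∃ λ r → r ∈ S × r ≢ x × TwoNeighbours S r
  dirac₁ free x {S} s∈ s≢x
    with low-degree free _ (x ∷ []) [] (S ∖ x) ℕ.≤-refl connected-[ x ] (λ ()) (inj₂ refl) (λ _ ())
           (λ { (here refl) v∈ → proj₂ (∈-∖⁻ {R = S} v∈) refl }) (λ ()) (∈-∖⁺ s∈ s≢x)
  ... | r , r∈ , p , q , cover = r , proj₁ (∈-∖⁻ r∈) , proj₂ (∈-∖⁻ {R = S} r∈) , endpoint x x p , endpoint x x q , two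
    where
    convert : ∀ b {u} → u ∈[ x ∷ [] , [] ] b → u ≡ endpoint x x b
    convert left   (here refl) = refl
    convert right  ()
    convert (pt p) eq          = eq
    locate : ∀ {u} → u ∈ S → u ∈ x ∷ [] ⊎ u ∈ [] ⊎ u ∈ S ∖ x
    locate {u} u∈ with u Fin.≟ x
    ... | yes eq = inj₁ (here eq)
    ... | no u≢x = inj₂ (inj₂ (∈-∖⁺ u∈ u≢x))
    two : ∀ {u} → u ∈ S → Edge G r u → u ≡ endpoint x x p ⊎ u ≡ endpoint x x q
    two u∈ e with cover (locate u∈) e
    ... | inj₁ i = inj₁ (convert p i)
    ... | inj₂ i = inj₂ (convert q i)

-- Suppression of a vertex as a minor operation

module Suppress (G : Graph n) (y : Fin n) {a b : Fin n} (a≢b : a ≢ b) where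

  -- The vertex y stays as an isolated vertex, so the vertex type is unchanged; an edge ab that is
  -- already present is not doubled.
  SuppressedEdge : Fin n → Fin n → Set
  SuppressedEdge u v = u ≢ y × v ≢ y × (Edge G u v ⊎ (u ≡ a × v ≡ b) ⊎ (u ≡ b × v ≡ a))

  suppressedEdge? : ∀ u v → Dec (SuppressedEdge u v)
  suppressedEdge? u v = ¬? (u Fin.≟ y) ×-dec ¬? (v Fin.≟ y) ×-dec
    (edge? G u v ⊎-dec (u Fin.≟ a ×-dec v Fin.≟ b) ⊎-dec (u Fin.≟ b ×-dec v Fin.≟ a))

  private
    reverse : ∀ {u v} → SuppressedEdge u v → SuppressedEdge v u
    reverse (u≢ , v≢ , inj₁ e)                = v≢ , u≢ , inj₁ (edge-sym G e)
    reverse (u≢ , v≢ , inj₂ (inj₁ (eq , eq′))) = v≢ , u≢ , inj₂ (inj₂ (eq′ , eq))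
    reverse (u≢ , v≢ , inj₂ (inj₂ (eq , eq′))) = v≢ , u≢ , inj₂ (inj₁ (eq′ , eq))

    loopless : ∀ {v} → ¬ SuppressedEdge v v
    loopless (_ , _ , inj₁ e)                     = edge-≢ G e refl
    loopless (_ , _ , inj₂ (inj₁ (refl , a≡b))) = a≢b a≡b
    loopless (_ , _ , inj₂ (inj₂ (b≡b , b≡a))) = a≢b (≡.trans (sym b≡a) b≡b)

  suppress : Graph n
  suppress = record
    { adj    = λ u v → does (suppressedEdge? u v)
    ; sym    = λ u v → does-⇔ (mk⇔ reverse reverse) (suppressedEdge? u v) (suppressedEdge? v u)
    ; irrefl = λ v → dec-false (suppressedEdge? v v) loopless }

  suppress⁺ : ∀ {u v} → SuppressedEdge u v → Edge suppress u v
  suppress⁺ e = dec-true (suppressedEdge? _ _) e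

  suppress⁻ : ∀ {u v} → Edge suppress u v → SuppressedEdge u v
  suppress⁻ {u} {v} = from-does (suppressedEdge? u v)

  -- In a minor of the suppressed graph, y joins the branch set of a.
  suppress-K4MinorFree : Edge G y a → Edge G y b → K4MinorFree G → K4MinorFree suppress
  suppress-K4MinorFree ya yb free (β , _ , conn , edges) = free (β′ , inhabited′ , conn′ , edges′)
    where
    β′ : Fin n → Maybe (Fin 4)
    β′ w with w Fin.≟ y
    ... | yes _ = β a
    ... | no _  = β w
    β′-y : β′ y ≡ β a
    β′-y with y Fin.≟ y
    ... | yes _  = refl
    ... | no y≢y = contradiction refl y≢y
    β′-≢ : ∀ {w} → w ≢ y → β′ w ≡ β w
    β′-≢ {w} w≢y with w Fin.≟ y
    ... | yes eq = contradiction eq w≢y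
    ... | no _   = refl
    edges′ : ∀ i j → i ≢ j → ∃₂ λ u v → β′ u ≡ just i × β′ v ≡ just j × Edge G u v
    edges′ i j i≢j with edges i j i≢j
    ... | u , v , βu , βv , e with suppress⁻ e
    ...   | u≢ , v≢ , inj₁ e′ = u , v , ≡.trans (β′-≢ u≢) βu , ≡.trans (β′-≢ v≢) βv , e′
    -- With y in the branch set of a, the edge yb replaces the new edge ab.
    ...   | u≢ , v≢ , inj₂ (inj₁ (refl , refl)) = y , v , ≡.trans β′-y βu , ≡.trans (β′-≢ v≢) βv , yb
    ...   | u≢ , v≢ , inj₂ (inj₂ (refl , refl)) = u , y , ≡.trans (β′-≢ u≢) βu , ≡.trans β′-y βv , edge-sym G yb
    inhabited′ : ∀ i → ∃ λ v → β′ v ≡ just i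
    inhabited′ i with edges′ i (proj₁ (another i)) (proj₂ (another i))
    ... | u , _ , eq , _ = u , eq
    path : ∀ {i u v} → β u ≡ just i → PathIn suppress (λ w → β w ≡ just i) u v → PathIn G (λ w → β′ w ≡ just i) u v
    path βu here = here
    path βu (step e βw p) with suppress⁻ e
    ... | u≢ , w≢ , inj₁ e′ = step e′ (≡.trans (β′-≢ w≢) βw) (path βw p)
    -- Inside a branch set, the new edge is rerouted through y.
    ... | u≢ , w≢ , inj₂ (inj₁ (refl , refl)) =
      step (edge-sym G ya) (≡.trans β′-y βu) (step yb (≡.trans (β′-≢ w≢) βw) (path βw p))
    ... | u≢ , w≢ , inj₂ (inj₂ (refl , refl)) =
      step (edge-sym G yb) (≡.trans β′-y βw) (step ya (≡.trans (β′-≢ w≢) βw) (path βw p))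
    a≢y : a ≢ y
    a≢y = edge-≢ G ya ∘ sym
    conn′ : ∀ i u v → β′ u ≡ just i → β′ v ≡ just i → PathIn G (λ w → β′ w ≡ just i) u v
    conn′ i u v eq eq′ with u Fin.≟ y | v Fin.≟ y
    ... | yes refl | yes refl = here
    ... | yes refl | no v≢ = step ya (≡.trans (β′-≢ a≢y) eq) (path eq (conn i a v eq eq′))
    ... | no u≢ | yes refl = path-trans G (path eq (conn i u a eq eq′))
      (step (edge-sym G ya) (≡.trans β′-y eq′) here)
    ... | no u≢ | no v≢ = path eq (conn i u v eq eq′)

-- Deleting vertices and suppressing them

pick : {v : Fin n} {R : List (Fin n)} → v ∈ R → ∃ λ R′ → R ↭ v ∷ R′
pick v∈ with ∈-∃++ v∈
... | xs , ys , refl = xs ++ ys , shift _ xs ys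

unique-↭ : {S S′ : List (Fin n)} → S ↭ S′ → Unique S → Unique S′
unique-↭ p = Unique-resp-↭ (≡.setoid _) (↭⇒↭ₛ p)

unique-∉ : {v : Fin n} {S : List (Fin n)} → Unique (v ∷ S) → v ∉ S
unique-∉ (v≢ ∷ _) v∈ = All.lookup v≢ v∈ refl

unique-tail : {v : Fin n} {S : List (Fin n)} → Unique (v ∷ S) → Unique S
unique-tail (_ ∷ uS) = uS

module _ (G : Graph n) where

  nbrs : Fin n → List (Fin n) → List (Fin n)
  nbrs v = filter (edge? G v)

  -- The edges induced on S, each listed once, from the earlier vertex to the later one.
  edges : List (Fin n) → List (Arc n)
  edges []      = []
  edges (v ∷ S) = map (v ,_) (nbrs v S) ++ edges S

  -- An edge uv changes its direction, so the two lists are permutations of each other only up to a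
  -- flip.
  edges-swap : ∀ u v S → edges (u ∷ v ∷ S) ≋ edges (v ∷ u ∷ S)
  edges-swap u v S = by-adjacency (edge? G u v)
    where
    by-adjacency : Dec (Edge G u v) → edges (u ∷ v ∷ S) ≋ edges (v ∷ u ∷ S)
    by-adjacency (yes e)
      rewrite filter-accept (edge? G u) {x = v} {xs = S} e
            | filter-accept (edge? G v) {x = u} {xs = S} (edge-sym G e) =
      ≋-trans (≋-flip u v _) (≋-∷ (v , u) (≋-↭ (shifts (map (u ,_) (nbrs u S)) (map (v ,_) (nbrs v S)))))
    by-adjacency (no ¬e)
      rewrite filter-reject (edge? G u) {x = v} {xs = S} ¬e
            | filter-reject (edge? G v) {x = u} {xs = S} (¬e ∘ edge-sym G) =
      ≋-↭ (shifts (map (u ,_) (nbrs u S)) (map (v ,_) (nbrs v S)))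

  edges-∷ : ∀ v {S S′} → S ↭ S′ → edges S ≋ edges S′ → edges (v ∷ S) ≋ edges (v ∷ S′)
  edges-∷ v {S} p eq = ≋-trans (≋-++ (map (v ,_) (nbrs v S)) eq) (≋-↭ (++⁺ʳ _ (map⁺ (v ,_) (filter-↭ (edge? G v) p))))

  edges-↭ : ∀ {S S′} → S ↭ S′ → edges S ≋ edges S′
  edges-↭ refl         = ≋-refl
  edges-↭ (prep v p)   = edges-∷ v p (edges-↭ p)
  edges-↭ (swap u v p) = ≋-trans (edges-swap u v _) (edges-∷ v (prep u p) (edges-∷ u p (edges-↭ p)))
  edges-↭ (trans p q)  = ≋-trans (edges-↭ p) (edges-↭ q)

  edges-∉ : ∀ {v S} → v ∉ S → v ∉V edges S
  edges-∉ {S = []}    _  = []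
  edges-∉ {S = w ∷ S} v∉ = All.++⁺
    (All.map⁺ (All.tabulate λ t∈ → (v∉ ∘ here ∘ sym) , λ { refl → v∉ (there (proj₁ (∈-filter⁻ (edge? G w) t∈))) }))
    (edges-∉ (v∉ ∘ there))

  nbrs-none : ∀ {v T} → (∀ {u} → u ∈ T → ¬ Edge G v u) → nbrs v T ≡ []
  nbrs-none no-edge = filter-none (edge? G _) (All.tabulate no-edge)

  nbrs-two : ∀ {v p q T} → Edge G v p → Edge G v q → (∀ {u} → u ∈ T → ¬ Edge G v u) → nbrs v (p ∷ q ∷ T) ≡ p ∷ q ∷ []
  nbrs-two {v} e e′ no-edge = ≡.trans (filter-accept (edge? G v) e)
    (cong (_ ∷_) (≡.trans (filter-accept (edge? G v) e′) (cong (_ ∷_) (nbrs-none no-edge))))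

  GoodOn : List (Fin n) → Exponent n → Set
  GoodOn S = Good (edges S)

  Good-↭ : ∀ {S S′ f} → S ↭ S′ → GoodOn S f → GoodOn S′ f
  Good-↭ p = Good-≋ (edges-↭ p)

-- The bound on out-degrees at vertices where f is 3. Each `⊖` lowers it by one: `two ⊖ x ⊖ y` is
-- the (2,2)-bound and `two ⊖ x ⊖ y ⊖ y` the (2,1)-bound.
two : Exponent n
two _ = + 2

coef-[] : (m : Exponent n) → (∀ v → m v ≡ 0ℤ) → coef [] m ≡ true
coef-[] m z = dec-true (Fin.all? (λ v → m v ℤ.≟ 0ℤ)) z

Good-[] : Good {n} [] two
Good-[] {n} = good zeros (coef-[] zeros (λ _ → refl)) (λ _ → ℤ.+≤+ ℕ.z≤n)
  where
  zeros : Exponent n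
  zeros _ = 0ℤ

two-⊖² : {x y v : Fin n} → x ≢ v → y ≢ v → (two ⊖ x ⊖ y) v ≡ + 2
two-⊖² {x = x} x≢ y≢ = ≡.trans (⊖-≢ (two ⊖ x) y≢) (⊖-≢ two x≢)

two-⊖³ : {x y z v : Fin n} → x ≢ v → y ≢ v → z ≢ v → (two ⊖ x ⊖ y ⊖ z) v ≡ + 2
two-⊖³ {x = x} {y} x≢ y≢ z≢ = ≡.trans (⊖-≢ (two ⊖ x ⊖ y) z≢) (two-⊖² x≢ y≢)

pigeonhole : {a b c p q : Fin n} {L : List (Fin n)} → Unique (a ∷ b ∷ c ∷ L) →
  (∀ {u} → u ∈ a ∷ b ∷ c ∷ L → u ≡ p ⊎ u ≡ q) → ⊥
pigeonhole ((a≢b ∷ a≢c ∷ _) ∷ (b≢c ∷ _) ∷ _) pq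
  with pq (here refl) | pq (there (here refl)) | pq (there (there (here refl)))
... | inj₁ refl | inj₁ refl | _         = a≢b refl
... | inj₁ refl | inj₂ refl | inj₁ refl = a≢c refl
... | inj₁ refl | inj₂ refl | inj₂ refl = b≢c refl
... | inj₂ refl | inj₂ refl | _         = a≢b refl
... | inj₂ refl | inj₁ refl | inj₂ refl = a≢c refl
... | inj₂ refl | inj₁ refl | inj₁ refl = b≢c refl

Good-star : {es : List (Arc n)} {f : Exponent n} {r p q : Fin n} → r ∉V es → (L : List (Fin n)) → Unique L →
  (∀ {u} → u ∈ L → u ≢ r) → (∀ {u} → u ∈ L → u ≡ p ⊎ u ≡ q) → Good es (f ⊖ r ⊖ r) → Good (map (r ,_) L ++ es) f
Good-star {r = r} ∉es [] _ _ _ g = Good-weaken r (Good-weaken r g)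
Good-star {r = r} ∉es (a ∷ []) _ ≢r _ g = Good-source₁ ∉es (≢r (here refl)) (Good-weaken r g)
Good-star ∉es (a ∷ b ∷ []) _ ≢r _ g = Good-source₂ ∉es (≢r (here refl)) (≢r (there (here refl))) g
Good-star ∉es (_ ∷ _ ∷ _ ∷ _) uL _ pq _ = ⊥-elim (pigeonhole uL pq)

module _ (G : Graph n) where

  -- As a source, r charges its at most two arcs to its own allowance, so no other bound changes.
  insert-low : ∀ {r S f} → Unique (r ∷ S) → TwoNeighbours G S r → f r ≡ + 2 → GoodOn G S f → GoodOn G (r ∷ S) f
  insert-low {r} {S} u (p , q , cover) fr g =
    Good-star (edges-∉ G (unique-∉ u)) (nbrs G r S) (Unique.filter⁺ (edge? G r) (unique-tail u))
      (λ u∈ → edge-≢ G (proj₂ (∈-filter⁻ (edge? G r) {xs = S} u∈)) ∘ sym)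
      (λ u∈ → cover (proj₁ (∈-filter⁻ (edge? G r) u∈)) (proj₂ (∈-filter⁻ (edge? G r) {xs = S} u∈)))
      (Good-foreign (edges-∉ G (unique-∉ u)) fr g)

  insert-isolated : ∀ {y x S} → Unique (y ∷ x ∷ S) → GoodOn G (x ∷ S) (two ⊖ x) → (∀ {u} → u ∈ x ∷ S → ¬ Edge G y u) →
    GoodOn G (y ∷ x ∷ S) (two ⊖ x ⊖ y ⊖ y)
  insert-isolated {y} {x} {S} u g no-edge rewrite nbrs-none G no-edge =
    Good-foreign (edges-∉ G (unique-∉ u)) (⊖-≢ two (unique-∉ u ∘ here ∘ sym)) g

  -- Vertices of low degree other than x are peeled off until x remains, with exponent 0. It serves
  -- where x takes the place of both terminals, or y is isolated.
  single : K4MinorFree G → ∀ k x S → length S ℕ.≤ k → Unique (x ∷ S) → GoodOn G (x ∷ S) (two ⊖ x ⊖ x)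
  single free k x [] len u = Good-foreign {f = two} {v = x} [] refl Good-[]
  single free (suc k) x (s ∷ S) len u
    with dirac₁ G free x {x ∷ s ∷ S} (there (here refl)) (unique-∉ u ∘ here ∘ sym)
  ... | r , here r≡x , r≢x , _ = contradiction r≡x r≢x
  ... | r , there r∈ , r≢x , p , q , cover with pick r∈
  ...   | S′ , perm = Good-↭ G (↭-sym perm′)
    (insert-low (unique-↭ perm′ u) (p , q , λ u∈ → cover (∈-resp-↭ (↭-sym perm′) (there u∈))) (two-⊖² (r≢x ∘ sym) (r≢x ∘ sym))
      (single free k x S′ (ℕ.≤-pred (ℕ.≤-trans (ℕ.≤-reflexive (sym (↭-length perm))) len)) (unique-tail (unique-↭ perm′ u))))
    where
    perm′ : x ∷ s ∷ S ↭ r ∷ x ∷ S′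
    perm′ = trans (prep x perm) (swap x r refl)

  Diamond : Fin n → Fin n → Set
  Diamond z y = ∃₂ λ a b → Edge G z a × Edge G z b × Edge G a b × Edge G a y × Edge G b y

  data Chain (x : Fin n) : Fin n → Set where
    start  : Chain x x
    extend : ∀ {z y} → Chain x z → Diamond z y → Chain x y

  Outcome : Fin n → Fin n → List (Fin n) → Set
  Outcome x y S = GoodOn G S (two ⊖ x ⊖ y ⊖ y) ⊎ (Chain x y × GoodOn G S (two ⊖ x ⊖ y))

  outcome-good : ∀ {x y} S → Outcome x y S → GoodOn G S (two ⊖ x ⊖ y)
  outcome-good {y = y} _ (inj₁ g)  = Good-weaken y g
  outcome-good _ (inj₂ (_ , g)) = g

Induction : ℕ → ℕ → Set
Induction n k = (G : Graph n) → K4MinorFree G → ∀ x y R → Unique (x ∷ y ∷ R) → length R ℕ.< k → Outcome G x y (x ∷ y ∷ R)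

-- The configuration in which y has the neighbours a, b, and a has the neighbours y, b, d

module Triangle (G : Graph n) {x y a b d : Fin n} {T : List (Fin n)}
  (u : Unique (y ∷ a ∷ b ∷ d ∷ T)) (x∈ : x ∈ d ∷ T)
  (ya : Edge G y a) (yb : Edge G y b) (ab : Edge G a b) (ad : Edge G a d)
  (y-only : ∀ {v} → v ∈ d ∷ T → ¬ Edge G y v) (a-only : ∀ {v} → v ∈ T → ¬ Edge G a v) where

  P : List (Arc n)
  P = edges G (b ∷ d ∷ T)

  y∉ : y ∉ a ∷ b ∷ d ∷ T
  y∉ = unique-∉ u
  a∉ : a ∉ b ∷ d ∷ T
  a∉ = unique-∉ (unique-tail u)
  b∉ : b ∉ d ∷ T
  b∉ = unique-∉ (unique-tail (unique-tail u))
  b≢a : b ≢ a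
  b≢a b≡a = a∉ (here (sym b≡a))
  d≢a : d ≢ a
  d≢a d≡a = a∉ (there (here (sym d≡a)))
  a≢y : a ≢ y
  a≢y a≡y = y∉ (here (sym a≡y))
  b≢y : b ≢ y
  b≢y b≡y = y∉ (there (here (sym b≡y)))
  d≢y : d ≢ y
  d≢y d≡y = y∉ (there (there (here (sym d≡y))))
  d≢b : d ≢ b
  d≢b d≡b = b∉ (here (sym d≡b))
  x≢y : x ≢ y
  x≢y refl = y∉ (there (there x∈))
  x≢a : x ≢ a
  x≢a refl = a∉ (there x∈)

  y∉P : y ∉V P
  y∉P = edges-∉ G (y∉ ∘ there)
  a∉P : a ∉V P
  a∉P = edges-∉ G a∉

  edges-≡ : edges G (y ∷ a ∷ b ∷ d ∷ T) ≡ (y , a) ∷ (y , b) ∷ (a , b) ∷ (a , d) ∷ P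
  edges-≡ rewrite nbrs-two G ya yb y-only | nbrs-two G ab ad a-only = refl

  spare : ∀ {es z w} → y ∉V es → a ∉V es → z ≢ y → z ≢ a → w ≢ y → w ≢ a → Good es (two ⊖ z ⊖ w) →
    Good es (two ⊖ z ⊖ w ⊖ y ⊖ y ⊖ a ⊖ a)
  spare {z = z} {w} y∉ a∉ zy za wy wa g =
    Good-foreign a∉ (≡.trans (⊖-≢ (two ⊖ z ⊖ w ⊖ y) (a≢y ∘ sym)) (two-⊖³ za wa (a≢y ∘ sym)))
      (Good-foreign y∉ (two-⊖² zy wy) g)

  -- The coefficient of y¹ in (y + a)(y + b) is a + b, a second copy of the edge ab. The coefficient
  -- of a² in (a + b)²(a + d) is d, so the rest may use exponent at most 1 at d.
  good₂₂ : Good P (two ⊖ x ⊖ d) → GoodOn G (y ∷ a ∷ b ∷ d ∷ T) (two ⊖ x ⊖ y)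
  good₂₂ g rewrite edges-≡ = Good-suppress
    ((a≢y , b≢y) ∷ (a≢y , d≢y) ∷ y∉P) a≢y b≢y
    (Good-square a∉P b≢a d≢a (Good-≗ (λ v → rearrange (δ x v) (δ d v) (δ y v) (δ a v))
      (spare y∉P a∉P x≢y x≢a d≢y d≢a g)))
    where
    rearrange : ∀ x d y a → + 2 - x - d - y - y - a - a ≡ + 2 - x - y - y - a - a - d
    rearrange = solve-∀

  -- With exponent 0 at y, the arcs ya and yb are charged to a and b.
  sinks : Good ((a , b) ∷ (a , d) ∷ P) (two ⊖ x ⊖ y ⊖ y ⊖ a ⊖ b) → GoodOn G (y ∷ a ∷ b ∷ d ∷ T) (two ⊖ x ⊖ y ⊖ y)
  sinks g rewrite edges-≡ = Good-sink y a zero₁ (Good-sink y b zero₂ g)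
    where
    zero₁ : (two ⊖ x ⊖ y ⊖ y) y ≡ 0ℤ
    zero₁ rewrite δ-≢ x≢y | δ-self y = refl
    zero₂ : (two ⊖ x ⊖ y ⊖ y ⊖ a) y ≡ 0ℤ
    zero₂ rewrite δ-≢ x≢y | δ-self y | δ-≢ a≢y = refl

  -- Once y is a sink, the coefficient of a¹ in (a + b)(a + d) is a second factor b + d.
  -- `Good-double` then raises d from 0 to 2 and frees at b the 1 that the arc yb takes.
  good₂₁-diamond : Edge G b d → Good P (two ⊖ x ⊖ d ⊖ d) → x ≢ d → GoodOn G (y ∷ a ∷ b ∷ d ∷ T) (two ⊖ x ⊖ y ⊖ y)
  good₂₁-diamond bd g x≢d = sinks (Good-suppress a∉P b≢a d≢a doubled)
    where
    P₀ : List (Arc n)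
    P₀ = map (b ,_) (nbrs G b T) ++ edges G (d ∷ T)
    P≡ : P ≡ (b , d) ∷ P₀
    P≡ rewrite filter-accept (edge? G b) {xs = T} bd = refl
    base : Good ((b , d) ∷ P₀) (two ⊖ x ⊖ d ⊖ d ⊖ y ⊖ y ⊖ a ⊖ a)
    base = subst (λ es → Good es _) P≡
      (Good-foreign a∉P (≡.trans (⊖-≢ (two ⊖ x ⊖ d ⊖ d ⊖ y) (a≢y ∘ sym)) (≡.trans (⊖-≢ (two ⊖ x ⊖ d ⊖ d) (a≢y ∘ sym)) (two-⊖³ x≢a d≢a d≢a)))
        (Good-foreign y∉P (two-⊖³ x≢y d≢y d≢y) g))
    bound : Exponent n
    bound = two ⊖ x ⊖ y ⊖ y ⊖ a ⊖ a
    bound-b : bound b ℤ.≤ + 2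
    bound-b = ℤ.≤-trans (⊖-≤ (two ⊖ x ⊖ y ⊖ y ⊖ a) a b) (ℤ.≤-trans (⊖-≤ (two ⊖ x ⊖ y ⊖ y) a b)
      (ℤ.≤-trans (⊖-≤ (two ⊖ x ⊖ y) y b) (ℤ.≤-trans (⊖-≤ (two ⊖ x) y b) (⊖-≤ two x b))))
    bound-d : bound d ≡ + 2
    bound-d rewrite δ-≢ x≢d | δ-≢ (d≢y ∘ sym) | δ-≢ (d≢a ∘ sym) = refl
    doubled : Good ((b , d) ∷ P) (two ⊖ x ⊖ y ⊖ y ⊖ a ⊖ b ⊖ a)
    doubled rewrite P≡ = Good-≗ (λ v → rearrange′ (δ x v) (δ b v) (δ y v) (δ a v))
      (Good-double d≢b bound-b bound-d (Good-≗ (λ v → rearrange (δ x v) (δ d v) (δ y v) (δ a v)) base))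
      where
      rearrange : ∀ x d y a → + 2 - x - d - d - y - y - a - a ≡ + 2 - x - y - y - a - a - d - d
      rearrange = solve-∀
      rearrange′ : ∀ x b y a → + 2 - x - y - y - a - a - b ≡ + 2 - x - y - y - a - b - a
      rearrange′ = solve-∀

  open Suppress G a (d≢b ∘ sym) using (suppress; suppress⁺; suppress⁻)

  -- As bd is no edge of G, the edge list of `suppress` on the remaining vertices is that of G with
  -- the arc bd put in front. Most of the proof is this comparison.
  good₂₁-chord : ¬ Edge G b d → GoodOn suppress (b ∷ d ∷ T) (two ⊖ x ⊖ b) → GoodOn G (y ∷ a ∷ b ∷ d ∷ T) (two ⊖ x ⊖ y ⊖ y)
  good₂₁-chord ¬bd g = sinks (Good-suppress a∉P b≢a d≢a (subst (λ es → Good es _) suppressed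
    (Good-≗ (λ v → rearrange (δ x v) (δ b v) (δ y v) (δ a v))
      (spare (edges-∉ suppress (y∉ ∘ there)) (edges-∉ suppress a∉) x≢y x≢a b≢y b≢a g))))
    where
    rearrange : ∀ x b y a → + 2 - x - b - y - y - a - a ≡ + 2 - x - y - y - a - b - a
    rearrange = solve-∀
    -- Pairs whose adjacency is the same before and after the suppression of a.
    Plain : Fin n → Fin n → Set
    Plain v w = v ≢ a × w ≢ a × ¬ (v ≡ b × w ≡ d) × ¬ (v ≡ d × w ≡ b)
    plain⁺ : ∀ {v w} → Plain v w → Edge G v w → Edge suppress v w
    plain⁺ (v≢ , w≢ , _) e = suppress⁺ (v≢ , w≢ , inj₁ e)
    plain⁻ : ∀ {v w} → Plain v w → Edge suppress v w → Edge G v w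
    plain⁻ (_ , _ , ¬bd , ¬db) e with suppress⁻ e
    ... | _ , _ , inj₁ e′        = e′
    ... | _ , _ , inj₂ (inj₁ eq) = contradiction eq ¬bd
    ... | _ , _ , inj₂ (inj₂ eq) = contradiction eq ¬db
    nbrs-plain : ∀ v S → (∀ {w} → w ∈ S → Plain v w) → nbrs suppress v S ≡ nbrs G v S
    nbrs-plain v [] plain = refl
    nbrs-plain v (w ∷ S) plain = by-adjacency (edge? G v w)
      where
      by-adjacency : Dec (Edge G v w) → nbrs suppress v (w ∷ S) ≡ nbrs G v (w ∷ S)
      by-adjacency (yes e) = ≡.trans (filter-accept (edge? suppress v) (plain⁺ (plain (here refl)) e))
        (≡.trans (cong (w ∷_) (nbrs-plain v S (plain ∘ there))) (sym (filter-accept (edge? G v) e)))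
      by-adjacency (no ¬e) = ≡.trans (filter-reject (edge? suppress v) (¬e ∘ plain⁻ (plain (here refl))))
        (≡.trans (nbrs-plain v S (plain ∘ there)) (sym (filter-reject (edge? G v) ¬e)))
    edges-plain : ∀ S → a ∉ S → b ∉ S → edges suppress S ≡ edges G S
    edges-plain [] _ _ = refl
    edges-plain (v ∷ S) a∉S b∉S = cong₂ (λ L es → map (v ,_) L ++ es)
      (nbrs-plain v S λ w∈ → (λ { refl → a∉S (here refl) }) , (λ { refl → a∉S (there w∈) }) ,
        (λ { (refl , _) → b∉S (here refl) }) , (λ { (_ , refl) → b∉S (there w∈) }))
      (edges-plain S (a∉S ∘ there) (b∉S ∘ there))
    suppressed : edges suppress (b ∷ d ∷ T) ≡ (b , d) ∷ P
    suppressed = ≡.trans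
      (cong₂ (λ L es → map (b ,_) L ++ es)
        (≡.trans (filter-accept (edge? suppress b) (suppress⁺ (b≢a , d≢a , inj₂ (inj₁ (refl , refl)))))
          (cong (d ∷_) (nbrs-plain b T λ w∈ → b≢a , (λ { refl → a∉ (there (there w∈)) }) ,
            (λ { (_ , refl) → unique-∉ (unique-tail (unique-tail (unique-tail u))) w∈ }) , (λ { (b≡d , _) → d≢b (sym b≡d) }))))
        (edges-plain (d ∷ T) (a∉ ∘ there) b∉))
      (cong (λ L → (b , d) ∷ map (b ,_) L ++ edges G (d ∷ T)) (sym (filter-reject (edge? G b) ¬bd)))

-- The induction

bring : {v w : Fin n} {S : List (Fin n)} → w ∷ v ∷ S ↭ v ∷ w ∷ S
bring = swap _ _ refl

module Step (G : Graph n) (free : K4MinorFree G) {x y : Fin n} {R : List (Fin n)}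
  (uS : Unique (x ∷ y ∷ R)) (ih : Induction n (length R)) where

  S : List (Fin n)
  S = x ∷ y ∷ R

  x∉ : x ∉ y ∷ R
  x∉ = unique-∉ uS
  y∉R : y ∉ R
  y∉R = unique-∉ (unique-tail uS)
  x≢y : x ≢ y
  x≢y = x∉ ∘ here

  shorter : ∀ {v R′} → R ↭ v ∷ R′ → length R′ ℕ.< length R
  shorter p = ℕ.≤-reflexive (sym (↭-length p))

  outcome-↭ : ∀ {S S′} → S ↭ S′ → Outcome G x y S → Outcome G x y S′
  outcome-↭ p (inj₁ g)       = inj₁ (Good-↭ G p g)
  outcome-↭ p (inj₂ (c , g)) = inj₂ (c , Good-↭ G p g)

  remove-low : ∀ {r} → r ∈ R → TwoNeighbours G S r → Outcome G x y S
  remove-low {r} r∈ (p , q , cover) with pick r∈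
  ... | R′ , perm = outcome-↭ (↭-sym perm′) (add (ih G free x y R′ (unique-tail u′) (shorter perm)))
    where
    perm′ : S ↭ r ∷ x ∷ y ∷ R′
    perm′ = trans (prep x (prep y perm)) (trans (prep x bring) bring)
    u′ : Unique (r ∷ x ∷ y ∷ R′)
    u′ = unique-↭ perm′ uS
    x≢r : x ≢ r
    x≢r x≡r = unique-∉ u′ (here (sym x≡r))
    y≢r : y ≢ r
    y≢r y≡r = unique-∉ u′ (there (here (sym y≡r)))
    low : TwoNeighbours G (x ∷ y ∷ R′) r
    low = p , q , λ u∈ → cover (∈-resp-↭ (↭-sym perm′) (there u∈))
    add : Outcome G x y (x ∷ y ∷ R′) → Outcome G x y (r ∷ x ∷ y ∷ R′)
    add (inj₁ g)       = inj₁ (insert-low G u′ low (two-⊖³ x≢r y≢r y≢r) g)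
    add (inj₂ (c , g)) = inj₂ (c , insert-low G u′ low (two-⊖² x≢r y≢r) g)

  y-first : Unique (y ∷ x ∷ R)
  y-first = unique-↭ bring uS

  sink-y : ∀ {es} w → Good es (two ⊖ x ⊖ y ⊖ y ⊖ w) → Good ((y , w) ∷ es) (two ⊖ x ⊖ y ⊖ y)
  sink-y w = Good-sink y w zero-y
    where
    zero-y : (two ⊖ x ⊖ y ⊖ y) y ≡ 0ℤ
    zero-y rewrite δ-≢ x≢y | δ-self y = refl

  -- Excluding the edge xy, `dirac₂` finds a vertex of R to delete; once R is empty, the single edge
  -- is charged to x.
  adjacent-terminals : Edge G x y → Outcome G x y S
  adjacent-terminals e = by-size R refl
    where
    by-size : ∀ R′ → R ≡ R′ → Outcome G x y S
    by-size (s ∷ R′) refl with dirac₂ G free e (x∉ ∘ there) y∉R (here refl)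
    ... | r , r∈ , low = remove-low r∈ low
    by-size [] refl = inj₁ (Good-↭ G bring edge-good)
      where
      edge-good : GoodOn G (y ∷ x ∷ []) (two ⊖ x ⊖ y ⊖ y)
      edge-good rewrite filter-accept (edge? G y) {xs = []} (edge-sym G e) =
        sink-y x (Good-≗ (λ v → rearrange (δ x v) (δ y v))
          (Good-foreign [] (two-⊖² x≢y x≢y) (Good-foreign {f = two} {v = x} [] refl Good-[])))
        where
        rearrange : ∀ x y → + 2 - x - x - y - y ≡ + 2 - x - y - y - x
        rearrange = solve-∀

  -- The vertex a is treated differently from b, so this is applied a second time with the two
  -- exchanged.
  module Corner {a b : Fin n} {R₂ : List (Fin n)} (perm : R ↭ a ∷ b ∷ R₂)
    (ya : Edge G y a) (yb : Edge G y b) (y-only : ∀ {v} → v ∈ x ∷ R → Edge G y v → v ≡ a ⊎ v ≡ b) where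

    permS : S ↭ y ∷ a ∷ b ∷ x ∷ R₂
    permS = trans (prep x (prep y perm)) (trans bring (prep y (trans bring (prep a bring))))

    uniq : Unique (y ∷ a ∷ b ∷ x ∷ R₂)
    uniq = unique-↭ permS uS

    a∈R : a ∈ R
    a∈R = ∈-resp-↭ (↭-sym perm) (here refl)

    a∉ : a ∉ b ∷ x ∷ R₂
    a∉ = unique-∉ (unique-tail uniq)
    b∉ : b ∉ x ∷ R₂
    b∉ = unique-∉ (unique-tail (unique-tail uniq))
    a≢b : a ≢ b
    a≢b = a∉ ∘ here

    outside : ∀ {v} → v ∈ x ∷ R₂ → ¬ Edge G y v
    outside {v} v∈ e with y-only (inside v∈) e
      where
      inside : ∀ {v} → v ∈ x ∷ R₂ → v ∈ x ∷ R
      inside (here eq)  = here eq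
      inside (there v∈) = there (∈-resp-↭ (↭-sym perm) (there (there v∈)))
    ... | inj₁ refl = a∉ (there v∈)
    ... | inj₂ refl = b∉ v∈

    fan : ∀ {d T} → x ∷ R₂ ↭ d ∷ T → Edge G a b → Edge G a d →
      (∀ {v} → v ∈ b ∷ x ∷ R₂ → Edge G a v → v ≡ b ⊎ v ≡ d) → Outcome G x y S
    fan {d} {T} permT ab ad a-only =
      outcome-↭ (↭-sym (trans permS (prep y (prep a (prep b permT))))) (by-chord (edge? G b d))
      where
      u′ : Unique (y ∷ a ∷ b ∷ d ∷ T)
      u′ = unique-↭ (prep y (prep a (prep b permT))) uniq
      back : ∀ {v} → v ∈ d ∷ T → v ∈ x ∷ R₂
      back = ∈-resp-↭ (↭-sym permT)
      a-only′ : ∀ {v} → v ∈ T → ¬ Edge G a v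
      a-only′ v∈ e with a-only (there (back (there v∈))) e
      ... | inj₁ refl = b∉ (back (there v∈))
      ... | inj₂ refl = unique-∉ (unique-tail (unique-tail (unique-tail u′))) v∈
      open Triangle G u′ (∈-resp-↭ permT (here refl)) ya yb ab ad (outside ∘ back) a-only′ hiding (a∉; b∉; x≢y)
      open Suppress G a (d≢b ∘ sym) using (suppress; suppress-K4MinorFree)
      short : ℕ.suc (length (b ∷ R₂)) ℕ.≤ length R
      short = shorter perm
      by-chord : Dec (Edge G b d) → Outcome G x y (y ∷ a ∷ b ∷ d ∷ T)
      -- Suppressing a leaves the bound 1 at b, which is a (2,2)-bound for (x, b) in the minor with the chord bd.
      by-chord (no ¬bd) = inj₁ (good₂₁-chord ¬bd (Good-↭ suppress (trans bring (prep b permT))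
        (outcome-good suppress (x ∷ b ∷ R₂) (ih suppress (suppress-K4MinorFree ab ad free) x b R₂
          (unique-↭ bring (unique-tail (unique-tail uniq))) (ℕ.<-trans (ℕ.n<1+n _) short)))))
      by-chord (yes bd) with d Fin.≟ x
      -- The diamond joins x to y directly, and the bound `two ⊖ x ⊖ d` is 0 at x = d, as in
      -- `single`.
      ... | yes refl = inj₂ (extend start (a , b , edge-sym G ad , edge-sym G bd , ab , edge-sym G ya , edge-sym G yb) ,
        good₂₂ (Good-↭ G (trans bring (prep b permT))
          (single G free _ x (b ∷ R₂) ℕ.≤-refl (unique-↭ bring (unique-tail (unique-tail uniq))))))
      ... | no d≢x with back (here refl)
      ...   | here d≡x = contradiction d≡x d≢x
      ...   | there d∈ with pick d∈
      -- With y and a deleted, the terminal moves from y to d; a chain from x to d is extended by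
      -- the diamond d, a, b, y.
      ...     | R₃ , permd = conclude (ih G free x d (b ∷ R₃) (unique-↭ permIH (unique-tail (unique-tail uniq)))
                (ℕ.≤-trans (s≤s (ℕ.≤-reflexive (sym (↭-length permd)))) (ℕ.<⇒≤ short)))
        where
        permIH : b ∷ x ∷ R₂ ↭ x ∷ d ∷ b ∷ R₃
        permIH = trans (prep b (prep x permd)) (trans bring (prep x bring))
        permP : x ∷ d ∷ b ∷ R₃ ↭ b ∷ d ∷ T
        permP = trans (↭-sym permIH) (prep b permT)
        conclude : Outcome G x d (x ∷ d ∷ b ∷ R₃) → Outcome G x y (y ∷ a ∷ b ∷ d ∷ T)
        conclude (inj₁ g)       = inj₁ (good₂₁-diamond bd (Good-↭ G permP g) (d≢x ∘ sym))
        conclude (inj₂ (c , g)) =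
          inj₂ (extend c (a , b , edge-sym G ad , edge-sym G bd , ab , edge-sym G ya , edge-sym G yb) , good₂₂ (Good-↭ G permP g))

    -- d is only a candidate. Unless both b and d are neighbours of a among these vertices, a has at
    -- most two neighbours, y included, and can be deleted.
    corner : (∃ λ d → ∀ {v} → v ∈ b ∷ x ∷ R₂ → Edge G a v → v ≡ b ⊎ v ≡ d) → Outcome G x y S
    corner (d , a-only) with edge? G a b | d ∈? (x ∷ R₂) ×-dec edge? G a d
    ... | yes ab | yes (d∈ , ad) with pick d∈
    ...   | T , permT = fan permT ab ad a-only
    corner (d , a-only) | no ¬ab | _ = remove-low a∈R (y , d , λ v∈ → cover (∈-resp-↭ permS v∈))
      where
      cover : ∀ {v} → v ∈ y ∷ a ∷ b ∷ x ∷ R₂ → Edge G a v → v ≡ y ⊎ v ≡ d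
      cover (here eq) e = inj₁ eq
      cover (there (here refl)) e = contradiction refl (edge-≢ G e)
      cover (there (there v∈)) e with a-only v∈ e
      ... | inj₁ refl = contradiction e ¬ab
      ... | inj₂ eq   = inj₂ eq
    corner (d , a-only) | yes _ | no ¬ad = remove-low a∈R (y , b , λ v∈ → cover (∈-resp-↭ permS v∈))
      where
      cover : ∀ {v} → v ∈ y ∷ a ∷ b ∷ x ∷ R₂ → Edge G a v → v ≡ y ⊎ v ≡ b
      cover (here eq) e = inj₁ eq
      cover (there (here refl)) e = contradiction refl (edge-≢ G e)
      cover (there (there (here eq))) e = inj₂ eq
      cover (there (there (there v∈))) e with a-only (there v∈) e
      ... | inj₁ eq   = inj₂ eq
      ... | inj₂ refl = contradiction (v∈ , e) ¬ad

  module TwoNeighbourTerminal {a b : Fin n} {R₂ : List (Fin n)} (perm : R ↭ a ∷ b ∷ R₂)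
    (ya : Edge G y a) (yb : Edge G y b) (y-only : ∀ {v} → v ∈ x ∷ R → Edge G y v → v ≡ a ⊎ v ≡ b) where

    open Corner perm ya yb y-only using (permS; uniq; a≢b; corner)
    open Corner (trans perm bring) yb ya (λ v∈ e → Sum.swap (y-only v∈ e)) using () renaming (corner to corner′)
    open Suppress G y a≢b using (suppress; suppress⁺; suppress-K4MinorFree)

    y∉ : y ∉ a ∷ b ∷ x ∷ R₂
    y∉ = unique-∉ uniq

    lift : ∀ {r v} → r ∈ a ∷ b ∷ x ∷ R₂ → v ∈ a ∷ b ∷ x ∷ R₂ → Edge G r v → Edge suppress r v
    lift r∈ v∈ e = suppress⁺ ((λ { refl → y∉ r∈ }) , (λ { refl → y∉ v∈ }) , inj₁ e)

    -- The known neighbour z uses up one of the two names, and d is the other.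
    third : ∀ {p q z : Fin n} → z ≡ p ⊎ z ≡ q → ∃ λ d → ∀ {v} → v ≡ p ⊎ v ≡ q → v ≡ z ⊎ v ≡ d
    third {q = q} (inj₁ refl) = q , λ eq → eq
    third {p = p} (inj₂ refl) = p , Sum.swap

    -- A low vertex of the suppressed graph, if it is a or b, spends one of its two neighbours on
    -- the new edge ab, which leaves a single further neighbour d. Any other low vertex is not
    -- adjacent to y and therefore is low in G too.
    outcome : Outcome G x y S
    outcome with dirac₁ suppress (suppress-K4MinorFree ya yb free) x {a ∷ b ∷ x ∷ R₂} (here refl)
                   (λ a≡x → unique-∉ (unique-tail uniq) (there (here a≡x)))
    ... | r , here refl , r≢x , p , q , cover
      with third (cover (there (here refl)) (suppress⁺ ((λ { refl → y∉ (here refl) }) , (λ { refl → y∉ (there (here refl)) }) , inj₂ (inj₁ (refl , refl)))))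
    ...   | d , only = corner (d , λ v∈ e → only (cover (there v∈) (lift (here refl) (there v∈) e)))
    outcome | r , there (here refl) , r≢x , p , q , cover
      with third (cover (here refl) (suppress⁺ ((λ { refl → y∉ (there (here refl)) }) , (λ { refl → y∉ (here refl) }) , inj₂ (inj₂ (refl , refl)))))
    ...   | d , only = corner′ (d , λ v∈ e → only (cover (skip v∈) (lift (there (here refl)) (skip v∈) e)))
      where
      skip : ∀ {v} → v ∈ a ∷ x ∷ R₂ → v ∈ a ∷ b ∷ x ∷ R₂
      skip (here eq)  = here eq
      skip (there v∈) = there (there v∈)
    outcome | r , there (there (here r≡x)) , r≢x , _ = contradiction r≡x r≢x
    outcome | r , there (there (there r∈)) , r≢x , p , q , cover =
      remove-low (∈-resp-↭ (↭-sym perm) (there (there r∈))) (p , q , λ v∈ → cover′ (∈-resp-↭ permS v∈))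
      where
      r∈′ : r ∈ x ∷ R
      r∈′ = there (∈-resp-↭ (↭-sym perm) (there (there r∈)))
      cover′ : ∀ {v} → v ∈ y ∷ a ∷ b ∷ x ∷ R₂ → Edge G r v → v ≡ p ⊎ v ≡ q
      cover′ (there v∈) e = cover v∈ (lift (there (there (there r∈))) v∈ e)
      cover′ (here refl) e with y-only r∈′ (edge-sym G e)
      ... | inj₁ refl = contradiction (there (there r∈)) (unique-∉ (unique-tail uniq))
      ... | inj₂ refl = contradiction (there r∈) (unique-∉ (unique-tail (unique-tail uniq)))

  -- Without neighbours, y costs nothing. With one neighbour b, the sink y charges b, which the
  -- (2,2)-claim for (x, b) without y permits. Two neighbours lead to the suppression of y.
  low-terminal : ¬ Edge G x y → TwoNeighbours G S y → Outcome G x y S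
  low-terminal ¬xy (p , q , cover) = by-nbrs (nbrs G y (x ∷ R)) refl
    where
    member : ∀ {L v} → nbrs G y (x ∷ R) ≡ L → v ∈ L → v ∈ x ∷ R × Edge G y v
    member refl v∈ = ∈-filter⁻ (edge? G y) {xs = x ∷ R} v∈
    member-R : ∀ {L v} → nbrs G y (x ∷ R) ≡ L → v ∈ L → v ∈ R
    member-R eq v∈ with member eq v∈
    ... | here refl , e = contradiction (edge-sym G e) ¬xy
    ... | there v∈R , _ = v∈R
    only : ∀ {L v} → nbrs G y (x ∷ R) ≡ L → v ∈ x ∷ R → Edge G y v → v ∈ L
    only refl v∈ e = ∈-filter⁺ (edge? G y) v∈ e
    unique-L : ∀ {L} → nbrs G y (x ∷ R) ≡ L → Unique L
    unique-L refl = Unique.filter⁺ (edge? G y) (unique-tail y-first)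
    among : ∀ {L v} → nbrs G y (x ∷ R) ≡ L → v ∈ L → v ≡ p ⊎ v ≡ q
    among eq v∈ with member eq v∈
    ... | here refl , e = cover (here refl) e
    ... | there v∈R , e = cover (there (there v∈R)) e
    by-nbrs : ∀ L → nbrs G y (x ∷ R) ≡ L → Outcome G x y S
    by-nbrs [] eq = inj₁ (Good-↭ G bring (insert-isolated G y-first (Good-weaken x (single G free _ x R ℕ.≤-refl (unique-tail y-first)))
      (λ v∈ e → nothing-in (only eq v∈ e))))
      where
      nothing-in : ∀ {v : Fin n} → v ∉ []
      nothing-in ()
    by-nbrs (b ∷ []) eq with pick (member-R eq (here refl))
    ... | R′ , perm = inj₁ (Good-↭ G bring attached)
      where
      permR : x ∷ b ∷ R′ ↭ x ∷ R
      permR = prep x (↭-sym perm)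
      rest : GoodOn G (x ∷ R) (two ⊖ x ⊖ b)
      rest = Good-↭ G permR (outcome-good G (x ∷ b ∷ R′) (ih G free x b R′ (unique-↭ (↭-sym permR) (unique-tail y-first)) (shorter perm)))
      y≢b : b ≢ y
      y≢b refl = y∉R (member-R eq (here refl))
      attached : GoodOn G (y ∷ x ∷ R) (two ⊖ x ⊖ y ⊖ y)
      attached = subst (λ L → Good (map (y ,_) L ++ edges G (x ∷ R)) _) (sym eq)
        (sink-y b (Good-≗ (λ v → rearrange (δ x v) (δ b v) (δ y v))
          (Good-foreign (edges-∉ G (unique-∉ y-first)) (two-⊖² x≢y y≢b) rest)))
        where
        rearrange : ∀ x b y → + 2 - x - b - y - y ≡ + 2 - x - y - y - b
        rearrange = solve-∀
    by-nbrs (a ∷ b ∷ []) eq with pick (member-R eq (here refl))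
    ... | R₁ , perm₁ with ∈-resp-↭ perm₁ (member-R eq (there (here refl)))
    ...   | here b≡a = contradiction (here (sym b≡a)) (unique-∉ (unique-L eq))
    ...   | there b∈ with pick b∈
    ...     | R₂ , perm₂ = TwoNeighbourTerminal.outcome (trans perm₁ (prep a perm₂))
                (proj₂ (member eq (here refl))) (proj₂ (member eq (there (here refl)))) (λ v∈ e → endpoint (only eq v∈ e))
      where
      endpoint : ∀ {v} → v ∈ a ∷ b ∷ [] → v ≡ a ⊎ v ≡ b
      endpoint (here eq)         = inj₁ eq
      endpoint (there (here eq)) = inj₂ eq
    by-nbrs (_ ∷ _ ∷ _ ∷ _) eq = ⊥-elim (pigeonhole (unique-L eq) (among eq))

  -- Adjacent terminals are split off so that all neighbours of y lie in R, where they can be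
  -- deleted or become terminals.
  outcome : Outcome G x y S
  outcome = by-adjacency (edge? G x y)
    where
    by-adjacency : Dec (Edge G x y) → Outcome G x y S
    by-adjacency (yes e) = adjacent-terminals e
    by-adjacency (no ¬e) with dirac₁ G free x {S} (there (here refl)) (x≢y ∘ sym)
    ... | _ , here r≡x , r≢x , _           = contradiction r≡x r≢x
    ... | _ , there (here refl) , _ , low  = low-terminal ¬e low
    ... | _ , there (there r∈) , _ , low   = remove-low r∈ low

induction : ∀ k → Induction n k
induction zero    G free x y R u ()
induction (suc k) G free x y R u (s≤s len) =
  Step.outcome G free u λ G′ free′ x′ y′ R′ u′ len′ → induction k G′ free′ x′ y′ R′ u′ (ℕ.<-≤-trans len′ len)

-- From odd coefficients to orientations

out in′ : List (Arc n) → Exponent n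
out F v = + outdegIn F v
in′ F v = + indegIn F v

out-∷ : (a b : Fin n) (F : List (Arc n)) → ∀ v → out ((a , b) ∷ F) v ≡ δ a v + out F v
out-∷ a b F v with does (a Fin.≟ v)
... | true  = refl
... | false = refl

in-∷ : (a b : Fin n) (F : List (Arc n)) → ∀ v → in′ ((a , b) ∷ F) v ≡ δ b v + in′ F v
in-∷ a b F v with does (b Fin.≟ v)
... | true  = refl
... | false = refl

Flip : Arc n → Arc n → Set
Flip e e′ = e′ ≡ e ⊎ e′ ≡ Product.swap e

-- An odd coefficient has at least one contributing choice of an end for every arc; the chosen ends
-- are the tails of an orientation with out-degrees m.
orient : (es : List (Arc n)) {m : Exponent n} → coef es m ≡ true → ∃ λ es′ → Pointwise Flip es es′ × m ≗ out es′
orient [] c = [] , [] , from-does (Fin.all? _) c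
orient ((a , b) ∷ es) {m} c = by-tail (coef es (m ⊖ a)) refl
  where
  restore : ∀ es′ c → m ⊖ c ≗ out es′ → ∀ v → m v ≡ δ c v + out es′ v
  restore es′ c eq v = ≡.trans (lemma (m v) (δ c v)) (cong (λ t → δ c v + t) (eq v))
    where
    lemma : ∀ x d → x ≡ d + (x - d)
    lemma = solve-∀
  by-tail : ∀ t → coef es (m ⊖ a) ≡ t → ∃ λ es′ → Pointwise Flip ((a , b) ∷ es) es′ × m ≗ out es′
  by-tail true eq with orient es eq
  ... | es′ , flips , outs = (a , b) ∷ es′ , inj₁ refl ∷ flips , λ v → ≡.trans (restore es′ a outs v) (sym (out-∷ a b es′ v))
  by-tail false eq with orient es (subst (λ t → t xor coef es (m ⊖ b) ≡ true) eq c)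
  ... | es′ , flips , outs = (b , a) ∷ es′ , inj₂ refl ∷ flips , λ v → ≡.trans (restore es′ b outs v) (sym (out-∷ b a es′ v))

≋-flips : {es es′ : List (Arc n)} → Pointwise Flip es es′ → es ≋ es′
≋-flips []                        = ≋-refl
≋-flips (inj₁ refl ∷ flips)       = ≋-∷ _ (≋-flips flips)
≋-flips {es = (u , v) ∷ es} (inj₂ refl ∷ flips) = ≋-trans (≋-flip u v es) (≋-∷ (v , u) (≋-flips flips))

-- The Alon-Tarsi correspondence modulo 2

parity-sum : {A : Set} → (A → Bool) → List A → Bool
parity-sum t []       = false
parity-sum t (x ∷ xs) = t x xor parity-sum t xs

parity-sum-++ : {A : Set} (t : A → Bool) (xs ys : List A) → parity-sum t (xs ++ ys) ≡ parity-sum t xs xor parity-sum t ys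
parity-sum-++ t []       ys = refl
parity-sum-++ t (x ∷ xs) ys = ≡.trans (cong (t x xor_) (parity-sum-++ t xs ys)) (sym (xor-assoc (t x) _ _))

parity-sum-map : {A B : Set} (t : B → Bool) (g : A → B) (xs : List A) → parity-sum t (map g xs) ≡ parity-sum (t ∘ g) xs
parity-sum-map t g []       = refl
parity-sum-map t g (x ∷ xs) = cong (t (g x) xor_) (parity-sum-map t g xs)

parity-sum-cong : {A : Set} {t t′ : A → Bool} → t ≗ t′ → parity-sum t ≗ parity-sum t′
parity-sum-cong eq []       = refl
parity-sum-cong eq (x ∷ xs) = cong₂ _xor_ (eq x) (parity-sum-cong eq xs)

-- Flipping the arcs of F in es turns the out-degrees into m; for m = out es this says that F is Eulerian.
Reorients : List (Arc n) → Exponent n → List (Arc n) → Set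
Reorients es m F = ∀ v → m v + out F v ≡ in′ F v + out es v

reorients? : (es : List (Arc n)) (m : Exponent n) (F : List (Arc n)) → Dec (Reorients es m F)
reorients? es m F = Fin.all? (λ v → m v + out F v ℤ.≟ in′ F v + out es v)

shifted-⇔ : {X X′ Y Y′ : Fin n → ℤ} (c : Fin n → ℤ) → (∀ v → X v ≡ X′ v + c v) → (∀ v → Y v ≡ Y′ v + c v) → X ≗ Y ⇔ X′ ≗ Y′
shifted-⇔ {X′ = X′} {Y′ = Y′} c eqX eqY = mk⇔
  (λ eq v → ∙-cancelʳ (c v) (X′ v) (Y′ v) (≡.trans (sym (eqX v)) (≡.trans (eq v) (eqY v))))
  (λ eq v → ≡.trans (eqX v) (≡.trans (cong (_+ c v) (eq v)) (sym (eqY v))))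

-- A choice of ends corresponds to the set F of arcs that contribute their head: leaving the first
-- arc out of F takes its tail a, putting it in takes its head b.
coef≡parity-sum : (es : List (Arc n)) (m : Exponent n) → coef es m ≡ parity-sum (does ∘ reorients? es m) (sublists es)
coef≡parity-sum [] m = ≡.trans
  (does-⇔ (mk⇔ (λ z v → cong (_+ 0ℤ) (z v)) (λ z v → ≡.trans (sym (ℤ.+-identityʳ (m v))) (z v))) (Fin.all? _) (reorients? [] m []))
  (sym (xor-identityʳ (does (reorients? [] m []))))
coef≡parity-sum ((a , b) ∷ es) m = ≡.trans (cong₂ _xor_ kept flipped)
  (≡.trans (cong (parity-sum (does ∘ reorients? ((a , b) ∷ es) m) (sublists es) xor_)
    (sym (parity-sum-map (does ∘ reorients? ((a , b) ∷ es) m) ((a , b) ∷_) (sublists es))))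
    (sym (parity-sum-++ (does ∘ reorients? ((a , b) ∷ es) m) (sublists es) (map ((a , b) ∷_) (sublists es)))))
  where
  kept : coef es (m ⊖ a) ≡ parity-sum (does ∘ reorients? ((a , b) ∷ es) m) (sublists es)
  kept = ≡.trans (coef≡parity-sum es (m ⊖ a)) (parity-sum-cong (λ F → does-⇔ (equivalent F) (reorients? es (m ⊖ a) F) (reorients? ((a , b) ∷ es) m F)) (sublists es))
    where
    lemma₁ : ∀ x d o → x - d + o ≡ x + o + - d
    lemma₁ = solve-∀
    lemma₂ : ∀ i d o → i + o ≡ i + (d + o) + - d
    lemma₂ = solve-∀
    equivalent : ∀ F → Reorients es (m ⊖ a) F ⇔ Reorients ((a , b) ∷ es) m F
    equivalent F = shifted-⇔ (λ v → - δ a v) (λ v → lemma₁ (m v) (δ a v) (out F v))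
      (λ v → ≡.trans (lemma₂ (in′ F v) (δ a v) (out es v)) (cong (λ o → in′ F v + o + - δ a v) (sym (out-∷ a b es v))))
  flipped : coef es (m ⊖ b) ≡ parity-sum (does ∘ reorients? ((a , b) ∷ es) m ∘ ((a , b) ∷_)) (sublists es)
  flipped = ≡.trans (coef≡parity-sum es (m ⊖ b))
    (parity-sum-cong (λ F → does-⇔ (equivalent F) (reorients? es (m ⊖ b) F) (reorients? ((a , b) ∷ es) m ((a , b) ∷ F))) (sublists es))
    where
    lemma₁ : ∀ x d e o → x - e + o ≡ x + (d + o) + (- d - e)
    lemma₁ = solve-∀
    lemma₂ : ∀ i d e o → i + o ≡ e + i + (d + o) + (- d - e)
    lemma₂ = solve-∀
    equivalent : ∀ F → Reorients es (m ⊖ b) F ⇔ Reorients ((a , b) ∷ es) m ((a , b) ∷ F)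
    equivalent F = shifted-⇔ (λ v → - δ a v - δ b v)
      (λ v → ≡.trans (lemma₁ (m v) (δ a v) (δ b v) (out F v)) (cong (λ o → m v + o + (- δ a v - δ b v)) (sym (out-∷ a b F v))))
      (λ v → ≡.trans (lemma₂ (in′ F v) (δ a v) (δ b v) (out es v))
        (cong₂ (λ i o → i + o + (- δ a v - δ b v)) (sym (in-∷ a b F v)) (sym (out-∷ a b es v))))

and-map⁺ : {A : Set} {t : A → Bool} (xs : List A) → (∀ x → t x ≡ true) → and (map t xs) ≡ true
and-map⁺ [] all = refl
and-map⁺ (x ∷ xs) all rewrite all x = and-map⁺ xs all

and-map⁻ : {A : Set} {t : A → Bool} {x : A} (xs : List A) → and (map t xs) ≡ true → x ∈ xs → t x ≡ true
and-map⁻ {t = t} (x ∷ xs) c x∈ with t x in eq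
and-map⁻ (x ∷ xs) c (here refl) | true = eq
and-map⁻ (x ∷ xs) c (there x∈)  | true = and-map⁻ xs c x∈

isEulerian≡ : (es F : List (Arc n)) → isEulerian F ≡ does (reorients? es (out es) F)
isEulerian≡ {n} es F = Bool.⇔→≡ (mk⇔
  (λ c → dec-true (reorients? es (out es) F) λ v → ≡.trans (ℤ.+-comm (out es v) (out F v))
    (cong (λ k → + k + out es v) (ℕ.≡ᵇ⇒≡ _ _ (subst T (sym (and-map⁻ (allFin n) c (∈-allFin v))) _))))
  (λ c → and-map⁺ (allFin n) λ v → balanced v (from-does (reorients? es (out es) F) c v)))
  where
  balanced : ∀ v → out es v + out F v ≡ in′ F v + out es v → (outdegIn F v ≡ᵇ indegIn F v) ≡ true
  balanced v eq = Equivalence.to Bool.T-≡ (ℕ.≡⇒≡ᵇ _ _ (ℤ.+-injective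
    (∙-cancelʳ (out es v) (out F v) (in′ F v) (≡.trans (ℤ.+-comm (out F v) (out es v)) eq))))

bit : Bool → ℤ
bit true  = 1ℤ
bit false = 0ℤ

HasParity : ℤ → Bool → Set
HasParity z b = ∃ λ k → z ≡ bit b + k * + 2

parity-+ : ∀ {z z′} b b′ → HasParity z b → HasParity z′ b′ → HasParity (z + z′) (b xor b′)
parity-+ true true (k , refl) (k′ , refl) = k + k′ + 1ℤ , lemma k k′
  where
  lemma : ∀ k k′ → 1ℤ + k * + 2 + (1ℤ + k′ * + 2) ≡ 0ℤ + (k + k′ + 1ℤ) * + 2
  lemma = solve-∀
parity-+ true false (k , refl) (k′ , refl) = k + k′ , lemma k k′
  where
  lemma : ∀ k k′ → 1ℤ + k * + 2 + (0ℤ + k′ * + 2) ≡ 1ℤ + (k + k′) * + 2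
  lemma = solve-∀
parity-+ false b′ (k , refl) (k′ , refl) = k + k′ , lemma k k′ (bit b′)
  where
  lemma : ∀ k k′ b → 0ℤ + k * + 2 + (b + k′ * + 2) ≡ b + (k + k′) * + 2
  lemma = solve-∀

parity-sign : ∀ k → HasParity (sign k) true
parity-sign zero = 0ℤ , refl
parity-sign (suc k) with parity-sign k
... | j , eq = - j - 1ℤ , ≡.trans (cong -_ eq) (lemma j)
  where
  lemma : ∀ j → - (1ℤ + j * + 2) ≡ 1ℤ + (- j - 1ℤ) * + 2
  lemma = solve-∀

odd-≢0 : ∀ {z} → HasParity z true → z ≢ 0ℤ
odd-≢0 (k , refl) eq = impossible ∣ k ∣ (≡.trans (sym (ℤ.abs-* k (+ 2))) (cong ∣_∣ twice))
  where
  lemma : ∀ x → x ≡ (1ℤ + x) - 1ℤ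
  lemma = solve-∀
  twice : k * + 2 ≡ - 1ℤ
  twice = ≡.trans (lemma (k * + 2)) (cong (_- 1ℤ) eq)
  impossible : ∀ j → j ℕ.* 2 ≢ 1
  impossible zero    ()
  impossible (suc j) ()

-- Every sign is odd, so modulo 2 the signed count is just the number of Eulerian sets.
parity-fold : (Fs : List (List (Arc n))) →
  HasParity (foldr (λ F acc → (if isEulerian F then sign (length F) else + 0) ℤ.+ acc) (+ 0) Fs) (parity-sum isEulerian Fs)
parity-fold []       = 0ℤ , refl
parity-fold (F ∷ Fs) = parity-+ (isEulerian F) (parity-sum isEulerian Fs) (term (isEulerian F)) (parity-fold Fs)
  where
  term : ∀ b → HasParity (if b then sign (length F) else + 0) b
  term true  = parity-sign (length F)
  term false = 0ℤ , refl

odd⇒AT : {G : Graph n} (D : Orientation G) → coef (arcs D) (out (arcs D)) ≡ true → IsATOrientation D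
odd⇒AT D c = odd-≢0 (subst (HasParity (diff D)) parity (parity-fold (sublists (arcs D))))
  where
  parity : parity-sum isEulerian (sublists (arcs D)) ≡ true
  parity = ≡.trans (parity-sum-cong (isEulerian≡ (arcs D)) (sublists (arcs D)))
    (≡.trans (sym (coef≡parity-sum (arcs D) (out (arcs D)))) c)

-- Arc lists of orientations

∈-arcs⁺ : {G : Graph n} (D : Orientation G) {u v : Fin n} → arc D u v ≡ true → (u , v) ∈ arcs D
∈-arcs⁺ {n} D {u} {v} e = ∈-concatMap⁺ _ (lose (∈-allFin u) (∈-concatMap⁺ _ (lose (∈-allFin v) single-arc)))
  where
  single-arc : (u , v) ∈ (if arc D u v then (u , v) ∷ [] else [])
  single-arc rewrite e = here refl

∈-arcs⁻ : {G : Graph n} (D : Orientation G) {u v : Fin n} → (u , v) ∈ arcs D → arc D u v ≡ true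
∈-arcs⁻ {n} D e∈ with find (∈-concatMap⁻ _ {xs = allFin n} e∈)
... | u , _ , e∈′ with find (∈-concatMap⁻ _ {xs = allFin n} e∈′)
...   | v , _ , e∈″ with arc D u v in eq
∈-arcs⁻ D e∈ | u , _ , e∈′ | v , _ , here refl | true = eq

-- `key` recovers from an element the block it lies in, so blocks of different indices are disjoint.
unique-concatMap : {A B : Set} {g : A → List B} (key : B → A) → (∀ {x y} → y ∈ g x → key y ≡ x) → (∀ x → Unique (g x)) →
  {xs : List A} → Unique xs → Unique (concatMap g xs)
unique-concatMap key keyed unique-g [] = []
unique-concatMap {g = g} key keyed unique-g {x ∷ xs} uxs@(_ ∷ uxs′) =
  Unique.++⁺ (unique-g x) (unique-concatMap key keyed unique-g uxs′) λ (y∈ , y∈′) → separate y∈ (find (∈-concatMap⁻ g {xs = xs} y∈′))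
  where
  separate : ∀ {y} → y ∈ g x → (∃ λ x′ → x′ ∈ xs × y ∈ g x′) → ⊥
  separate y∈ (x′ , x′∈ , y∈′) with ≡.trans (sym (keyed y∈)) (keyed y∈′)
  ... | refl = Unique.Unique[x∷xs]⇒x∉xs uxs x′∈

unique-arcs : {G : Graph n} (D : Orientation G) → Unique (arcs D)
unique-arcs {n} D = unique-concatMap proj₁ tail-key
  (λ u → unique-concatMap proj₂ (head-key u) (λ v → unique-at u v) (Unique.allFin⁺ n)) (Unique.allFin⁺ n)
  where
  at : Fin n → Fin n → List (Arc n)
  at u v = if arc D u v then (u , v) ∷ [] else []
  at≡ : ∀ u v {e} → e ∈ at u v → e ≡ (u , v)
  at≡ u v e∈ with arc D u v
  at≡ u v (here eq) | true = eq
  head-key : ∀ u {v e} → e ∈ at u v → proj₂ e ≡ v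
  head-key u {v} e∈ = cong proj₂ (at≡ u v e∈)
  tail-key : ∀ {u e} → e ∈ concatMap (at u) (allFin n) → proj₁ e ≡ u
  tail-key {u} e∈ with find (∈-concatMap⁻ (at u) {xs = allFin n} e∈)
  ... | v , _ , e∈′ = cong proj₁ (at≡ u v e∈′)
  unique-at : ∀ u v → Unique (at u v)
  unique-at u v with arc D u v
  ... | true  = [] ∷ []
  ... | false = []

-- Plain inequality would not survive flips, since an arc and the reverse of another could become
-- equal.
Distinct : Arc n → Arc n → Set
Distinct e e′ = e ≢ e′ × e ≢ Product.swap e′

distinct-flip : {e e′ f f′ : Arc n} → Flip e e′ → Flip f f′ → Distinct e f → Distinct e′ f′
distinct-flip (inj₁ refl) (inj₁ refl) d           = d
distinct-flip (inj₁ refl) (inj₂ refl) (≢₁ , ≢₂) = ≢₂ , ≢₁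
distinct-flip (inj₂ refl) (inj₁ refl) (≢₁ , ≢₂) = (λ { refl → ≢₂ refl }) , (λ eq → ≢₁ (cong Product.swap eq))
distinct-flip (inj₂ refl) (inj₂ refl) (≢₁ , ≢₂) = (λ eq → ≢₁ (cong Product.swap eq)) , (λ eq → ≢₂ (cong Product.swap eq))

distinct-flips : {es es′ : List (Arc n)} → Pointwise Flip es es′ → AllPairs Distinct es → AllPairs Distinct es′
distinct-flips [] [] = []
distinct-flips (f ∷ flips) (d ∷ ds) = all flips d ∷ distinct-flips flips ds
  where
  all : ∀ {es es′} → Pointwise Flip es es′ → All (Distinct _) es → All (Distinct _) es′
  all [] [] = []
  all (f′ ∷ flips) (d ∷ ds) = distinct-flip f f′ d ∷ all flips ds

distinct-oneDir : {es : List (Arc n)} {u v : Fin n} → AllPairs Distinct es → u ≢ v → (u , v) ∈ es → (v , u) ∈ es → ⊥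
distinct-oneDir (_ ∷ _)  u≢v (here refl) (here eq)  = u≢v (sym (cong proj₁ eq))
distinct-oneDir (d ∷ _)  u≢v (here refl) (there q)  = proj₂ (All.lookup d q) refl
distinct-oneDir (d ∷ _)  u≢v (there p) (here refl)  = proj₂ (All.lookup d p) refl
distinct-oneDir (_ ∷ ds) u≢v (there p) (there q)    = distinct-oneDir ds u≢v p q

flips-∈⁺ : {es es′ : List (Arc n)} {e : Arc n} → Pointwise Flip es es′ → e ∈ es → e ∈ es′ ⊎ Product.swap e ∈ es′
flips-∈⁺ (inj₁ refl ∷ _) (here refl) = inj₁ (here refl)
flips-∈⁺ (inj₂ refl ∷ _) (here refl) = inj₂ (here refl)
flips-∈⁺ (_ ∷ flips)     (there e∈) with flips-∈⁺ flips e∈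
... | inj₁ i = inj₁ (there i)
... | inj₂ i = inj₂ (there i)

flips-∈⁻ : {es es′ : List (Arc n)} {e : Arc n} → Pointwise Flip es es′ → e ∈ es′ → e ∈ es ⊎ Product.swap e ∈ es
flips-∈⁻ (inj₁ refl ∷ _) (here refl) = inj₁ (here refl)
flips-∈⁻ (inj₂ refl ∷ _) (here refl) = inj₂ (here refl)
flips-∈⁻ (_ ∷ flips)     (there e∈) with flips-∈⁻ flips e∈
... | inj₁ i = inj₁ (there i)
... | inj₂ i = inj₂ (there i)

module _ (G : Graph n) where

  ∈-edges⁻ : ∀ S {u v} → (u , v) ∈ edges G S → u ∈ S × v ∈ S × Edge G u v
  ∈-edges⁻ (s ∷ S) e∈ with ∈-++⁻ (map (s ,_) (nbrs G s S)) e∈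
  ... | inj₂ e∈′ = Product.map there (Product.map there (λ e → e)) (∈-edges⁻ S e∈′)
  ... | inj₁ e∈′ with ∈-map⁻ (s ,_) e∈′
  ...   | v , v∈ , refl = here refl , there (proj₁ (∈-filter⁻ (edge? G s) v∈)) , proj₂ (∈-filter⁻ (edge? G s) {xs = S} v∈)

  ∈-edges⁺ : ∀ S {u v} → u ∈ S → v ∈ S → Edge G u v → (u , v) ∈ edges G S ⊎ (v , u) ∈ edges G S
  ∈-edges⁺ (s ∷ S) (here refl) (here refl) e = contradiction refl (edge-≢ G e)
  ∈-edges⁺ (s ∷ S) (here refl) (there v∈) e = inj₁ (∈-++⁺ˡ (∈-map⁺ (s ,_) (∈-filter⁺ (edge? G s) v∈ e)))
  ∈-edges⁺ (s ∷ S) (there u∈) (here refl) e = inj₂ (∈-++⁺ˡ (∈-map⁺ (s ,_) (∈-filter⁺ (edge? G s) u∈ (edge-sym G e))))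
  ∈-edges⁺ (s ∷ S) (there u∈) (there v∈) e with ∈-edges⁺ S u∈ v∈ e
  ... | inj₁ i = inj₁ (∈-++⁺ʳ _ i)
  ... | inj₂ i = inj₂ (∈-++⁺ʳ _ i)

  distinct-edges : ∀ {S} → Unique S → AllPairs Distinct (edges G S)
  distinct-edges [] = []
  distinct-edges {s ∷ S} uS@(_ ∷ uS′) = AllPairs.++⁺
    (AllPairs.map⁺ (AllPairs.map (λ u≢v → (λ eq → u≢v (cong proj₂ eq)) , λ eq → u≢v (≡.trans (cong proj₂ eq) (cong proj₁ eq)))
      (Unique.filter⁺ (edge? G s) uS′)))
    (distinct-edges uS′)
    (All.tabulate λ e∈ → All.tabulate λ {f} f∈ → separate (∈-map⁻ (s ,_) e∈) (∈-edges⁻ S f∈))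
    where
    separate : ∀ {e f} → (∃ λ v → v ∈ nbrs G s S × e ≡ (s , v)) → proj₁ f ∈ S × proj₂ f ∈ S × _ → Distinct e f
    separate (_ , _ , refl) (u∈ , v∈ , _) =
      (λ { refl → unique-∉ uS u∈ }) , (λ { refl → unique-∉ uS v∈ })

  open import Data.List.Membership.DecPropositional (≡-dec (Fin._≟_ {n}) (Fin._≟_ {n})) using () renaming (_∈?_ to _∈ₐ?_)

  realise : ∀ {f} → GoodOn G (allFin n) f → ∃ λ (D : Orientation G) → IsATOrientation D × (∀ v → + outdeg D v ℤ.≤ f v)
  realise {f} (good m c m≤) with orient (edges G (allFin n)) c
  ... | es , flips , outs = D , odd⇒AT D odd-D , λ v → subst (ℤ._≤ f v) (≡.trans (outs v) (sym (out≡ v))) (m≤ v)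
    where
    es-distinct : AllPairs Distinct es
    es-distinct = distinct-flips flips (distinct-edges (Unique.allFin⁺ n))
    es-edge : ∀ {u v} → (u , v) ∈ es → Edge G u v
    es-edge e∈ with flips-∈⁻ flips e∈
    ... | inj₁ i = proj₂ (proj₂ (∈-edges⁻ (allFin n) i))
    ... | inj₂ i = edge-sym G (proj₂ (proj₂ (∈-edges⁻ (allFin n) i)))
    es-direction : ∀ {u v} → Edge G u v → (u , v) ∈ es ⊎ (v , u) ∈ es
    es-direction {u} {v} e with ∈-edges⁺ (allFin n) (∈-allFin u) (∈-allFin v) e
    ... | inj₁ i = flips-∈⁺ flips i
    ... | inj₂ i = Sum.swap (flips-∈⁺ flips i)
    one-direction : ∀ u v → Edge G u v → does ((u , v) ∈ₐ? es) ≡ not (does ((v , u) ∈ₐ? es))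
    one-direction u v e with es-direction e
    ... | inj₁ i = ≡.trans (dec-true (_ ∈ₐ? es) i)
      (cong not (sym (dec-false ((v , u) ∈ₐ? es) (distinct-oneDir es-distinct (edge-≢ G e) i))))
    ... | inj₂ i = ≡.trans (dec-false (_ ∈ₐ? es) (λ j → distinct-oneDir es-distinct (edge-≢ G e) j i))
      (cong not (sym (dec-true ((v , u) ∈ₐ? es) i)))
    D : Orientation G
    D = record
      { arc      = λ u v → does ((u , v) ∈ₐ? es)
      ; arc⊆edge = λ u v a → es-edge (from-does ((u , v) ∈ₐ? es) a)
      ; oneDir   = one-direction }
    -- Two duplicate-free lists with the same members are permutations of each other, so out-degrees
    -- and coefficients pass from `es` to `arcs D`.
    arcs↭ : arcs D ↭ es
    arcs↭ = ∼bag⇒↭ (unique∧set⇒bag (unique-arcs D) (AllPairs.map proj₁ es-distinct)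
      (mk⇔ (λ e∈ → from-does (_ ∈ₐ? es) (∈-arcs⁻ D e∈)) (λ e∈ → ∈-arcs⁺ D (dec-true (_ ∈ₐ? es) e∈))))
    out≡ : ∀ v → out (arcs D) v ≡ out es v
    out≡ v = cong +_ (↭-length (filter-↭ (λ a → proj₁ a Fin.≟ v) arcs↭))
    odd-D : coef (arcs D) (out (arcs D)) ≡ true
    odd-D = ≡.trans (coef-cong (arcs D) (λ v → ≡.trans (out≡ v) (sym (outs v))))
      (≡.trans (coef-≡ (≋-trans (≋-↭ arcs↭) (≋-sym (≋-flips flips))) m) c)

  -- The walk runs from y back to x, so that the diamond added last becomes the first one of the
  -- homomorphism.
  ChainWalk : Fin n → Fin n → Set
  ChainWalk x y = ∃ λ k → ∃ λ (φ : DiamondHom G k) → DiamondHom.u φ zero ≡ y × DiamondHom.u φ (fromℕ k) ≡ x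

  chain-walk : ∀ {x y} → Chain G x y → ChainWalk x y
  chain-walk {x} start = 0 , record { u = λ _ → x ; v = λ () ; w = λ () ; e-uv = λ () ; e-uw = λ () ; e-vw = λ () ; e-vu = λ () ; e-wu = λ () } , refl , refl
  chain-walk {x} (extend {z} {y} c (a , b , za , zb , ab , ay , by)) with chain-walk c
  ... | k , φ , refl , end = suc k , record
    { u = λ { zero → y ; (suc i) → DiamondHom.u φ i }
    ; v = λ { zero → a ; (suc i) → DiamondHom.v φ i }
    ; w = λ { zero → b ; (suc i) → DiamondHom.w φ i }
    ; e-uv = λ { zero → edge-sym G ay ; (suc i) → DiamondHom.e-uv φ i }
    ; e-uw = λ { zero → edge-sym G by ; (suc i) → DiamondHom.e-uw φ i }
    ; e-vw = λ { zero → ab ; (suc i) → DiamondHom.e-vw φ i }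
    ; e-vu = λ { zero → edge-sym G za ; (suc i) → DiamondHom.e-vu φ i }
    ; e-wu = λ { zero → edge-sym G zb ; (suc i) → DiamondHom.e-wu φ i }
    } , refl , end

  chain-connected : ∀ {x y} → Chain G x y → ChainConnected G x y
  chain-connected c with chain-walk c
  ... | k , φ , start≡ , end≡ = k , φ , (fromℕ k , end≡) , (zero , start≡)

  extendable : ∀ {x y f} a b → (f x ℤ.≤ + (a ∸ 1)) → (f y ℤ.≤ + (b ∸ 1)) → (∀ v → f v ℤ.≤ + 2) →
    GoodOn G (allFin n) f → ATExtendable G x y a b
  extendable {x} {y} {f} a b fx fy f≤ g with realise g
  ... | D , at , outs = D , at , λ v → ℤ.drop‿+≤+ (ℤ.≤-trans (outs v) (bound v))
    where
    bound : ∀ v → f v ℤ.≤ + (fxy x y a b v ∸ 1)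
    bound v with v Fin.≟ x
    ... | yes refl = fx
    ... | no _ with v Fin.≟ y
    ...   | yes refl = fy
    ...   | no _     = f≤ v

theorem1 : ∀ {n} (G : Graph n) → K4MinorFree G → (x y : Fin n) → x ≢ y →
    ATExtendable G x y 2 2 × (¬ ChainConnected G x y → ATExtendable G x y 2 1)
theorem1 {n} G free x y x≢y with pick (∈-allFin x)
... | R₁ , perm₁ with ∈-resp-↭ perm₁ (∈-allFin y)
...   | here y≡x = contradiction (sym y≡x) x≢y
...   | there y∈ with pick y∈
...     | R , perm₂ = extendable₂₂ outcome , λ ¬chain → extendable₂₁ ¬chain outcome
  where
  perm : allFin n ↭ x ∷ y ∷ R
  perm = trans perm₁ (prep x perm₂)
  outcome : Outcome G x y (x ∷ y ∷ R)
  outcome = induction _ G free x y R (unique-↭ perm (Unique.allFin⁺ n)) ℕ.≤-refl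
  extendable₂₂ : Outcome G x y (x ∷ y ∷ R) → ATExtendable G x y 2 2
  extendable₂₂ o = extendable G 2 2 at-x at-y (λ v → ℤ.≤-trans (⊖-≤ (two ⊖ x) y v) (⊖-≤ two x v))
    (Good-↭ G (↭-sym perm) (outcome-good G (x ∷ y ∷ R) o))
    where
    at-x : (two ⊖ x ⊖ y) x ℤ.≤ + 1
    at-x rewrite δ-self x | δ-≢ (x≢y ∘ sym) = ℤ.≤-refl
    at-y : (two ⊖ x ⊖ y) y ℤ.≤ + 1
    at-y rewrite δ-self y | δ-≢ x≢y = ℤ.≤-refl
  extendable₂₁ : ¬ ChainConnected G x y → Outcome G x y (x ∷ y ∷ R) → ATExtendable G x y 2 1
  extendable₂₁ ¬chain (inj₂ (chain , _)) = contradiction (chain-connected G chain) ¬chain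
  extendable₂₁ ¬chain (inj₁ g) = extendable G 2 1 at-x at-y
    (λ v → ℤ.≤-trans (⊖-≤ (two ⊖ x ⊖ y) y v) (ℤ.≤-trans (⊖-≤ (two ⊖ x) y v) (⊖-≤ two x v)))
    (Good-↭ G (↭-sym perm) g)
    where
    at-x : (two ⊖ x ⊖ y ⊖ y) x ℤ.≤ + 1
    at-x rewrite δ-self x | δ-≢ (x≢y ∘ sym) = ℤ.≤-refl
    at-y : (two ⊖ x ⊖ y ⊖ y) y ℤ.≤ + 0
    at-y rewrite δ-self y | δ-≢ x≢y = ℤ.≤-refl
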